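{- Let $X$ be a recursively presented Polish space of type at most $1$. Then there is a recursive map $u^X_s:\omega^\omega\times X\to\omega^\omega$ such that for each $1\le\xi<\omega_1$, each $\gamma\in BC_\xi$ and each $x\in X$, $u^X_s(\gamma,x)\in BC_\xi$, and $\rho^Y[u^X_s(\gamma,x)]=\rho^{X\times Y}(\gamma)_x$ for each recursively presented Polish space $Y$.
   Context: For $E\subseteq X\times Y$ and $x\in X$, $E_x:=\{y\in Y\mid(x,y)\in E\}$. Effective notions (recursively presented Polish spaces, recursive functions) are those of Moschovakis' book "Descriptive Set Theory". Each recursively presented Polish space $X$ has its standard effective enumeration $(N(X,k))_{k\in\omega}$ of a neighbourhood basis (possibly with empty sets; $N(X,0)=\emptyset$). $X$ is of type at most $1$ if it is a finite product of spaces equal to $\omega$, $\omega^\omega$ or $2^\omega$. $B\in\Sigma^0_1(X)$ iff $B=\bigcup_{i}N(X,\varepsilon(i))$ for some recursive $\varepsilon:\omega\to\omega$. A map $f:X\to Y$ is recursive if $\{(x,k)\mid f(x)\in N(Y,k)\}\in\Sigma^0_1(X\times\omega)$. Fix a good parametrization: sets $G^X\in\Sigma^0_1(\omega^\omega\times X)$, one for each recursively presented Polish $X$, such that $P\subseteq X$ is open iff $P=G^X_\gamma$ for some $\gamma\in\omega^\omega$, $P$ is $\Sigma^0_1$ iff $P=G^X_\gamma$ for some recursive $\gamma$, and for $X$ of type at most 1 and any $Y$ there is a recursive $S^{X,Y}:\omega^\omega\times X\to\omega^\omega$ with $(\gamma,x,y)\in G^{X\times Y}\Leftrightarrow(S^{X,Y}(\gamma,x),y)\in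 G^Y$. For $\gamma\in\omega^\omega$, $\{\gamma\}^{X,Y}$ is the partial function from $X$ to $Y$ with $\{\gamma\}^{X,Y}(x)$ defined and equal to $y$ iff $y$ is the (unique) point with $\forall k\,[y\in N(Y,k)\Leftrightarrow(\gamma,x,k)\in G^{X\times\omega}]$; write $\{\gamma\}$ when $Y=\omega^\omega$. Borel codes: let $\gamma^*(i):=\gamma(i+1)$. $BC_1:=\{\gamma\in\omega^\omega\mid\gamma(0)=0\}$ and for $2\le\xi<\omega_1$, $BC_\xi:=\{\gamma\in\omega^\omega\mid\gamma(0)=1$ and $\forall i\in\omega$, $\{\gamma^*\}(i)$ is defined and in $\bigcup_{1\le\eta<\xi}BC_\eta\}$; $BC:=\bigcup_{1\le\xi<\omega_1}BC_\xi$. For $\gamma\in BC$, $\rho^X(\gamma):=\bigcup_iN(X,\gamma^*(i))$ if $\gamma\in BC_1$, and $\rho^X(\gamma):=\bigcup_iX\setminus\rho^X(\{\gamma^*\}(i))$ otherwise. -}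

module Defs where

open import Data.Bool.Base using (Bool; true; false)
open import Data.Empty using (⊥)
open import Data.Fin.Base using (Fin; zero; suc)
open import Data.Integer.Base as ℤ using (+_; -[1+_])
import Data.Integer.Properties as ℤ
open import Data.Nat.Base
open import Data.Nat.GeneralisedArithmetic using (fold)
open import Data.Nat.Properties
open import Data.Product.Base using (∃; _×_; _,_; proj₁; proj₂; <_,_>)
open import Data.Rational.Unnormalised.Base as ℚ using (ℚᵘ; mkℚᵘ; 0ℚᵘ; 1ℚᵘ; *<*; *≤*)
import Data.Rational.Unnormalised.Properties as ℚ
open import Data.Sum.Base using (_⊎_; inj₁; inj₂; [_,_])
open import Data.Unit.Base using (⊤; tt)
open import Data.Vec.Base using (Vec; []; _∷_; lookup; tabulate)
open import Function.Base using (id; _∘_; const)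
open import Function.Bundles using (_⇔_; mk⇔; Equivalence)
open import Level using (0ℓ)
open import Relation.Binary.PropositionalEquality hiding ([_])
open import Relation.Nullary using (¬_; Dec; yes; no; contradiction)
import Relation.Nullary.Decidable as Dec
open import Relation.Unary using (Pred; Decidable; _∈_; _≐_)

open Equivalence using (to; from)

data Recursive : ∀ {n} → (Vec ℕ n → ℕ) → Set where
  constant : ∀ {n} c → Recursive {n} (λ _ → c)
  suc   : Recursive {1} (λ v → suc (lookup v zero))
  proj  : ∀ {n} (i : Fin n) → Recursive (λ v → lookup v i)
  comp  : ∀ {m n} {f : Vec ℕ m → ℕ} {g : Fin m → Vec ℕ n → ℕ} →
          Recursive f → (∀ i → Recursive (g i)) →
          Recursive (λ v → f (tabulate (λ i → g i v)))
  rec   : ∀ {n} {f : Vec ℕ (suc n) → ℕ} {g : Vec ℕ n → ℕ} {h : Vec ℕ (2 + n) → ℕ} →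
          Recursive g → Recursive h →
          (∀ v → f (0 ∷ v) ≡ g v) →
          (∀ m v → f (suc m ∷ v) ≡ h (m ∷ f (m ∷ v) ∷ v)) →
          Recursive f
  -- f v is the least m with g (m ∷ v) ≡ 0; in particular there is one.
  min   : ∀ {n} {f : Vec ℕ n → ℕ} {g : Vec ℕ (suc n) → ℕ} →
          Recursive g →
          (∀ v → g (f v ∷ v) ≡ 0) →
          (∀ v m → m < f v → g (m ∷ v) ≢ 0) →
          Recursive f
  -- Pointwise equal functions are the same function.
  ext   : ∀ {n} {f g : Vec ℕ n → ℕ} → f ≗ g → Recursive f → Recursive g

Recursive₁ : (ℕ → ℕ) → Set
Recursive₁ f = Recursive {1} (λ v → f (lookup v zero))

Recursive₂ : (ℕ → ℕ → ℕ) → Set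
Recursive₂ f = Recursive {2} (λ v → f (lookup v zero) (lookup v (suc zero)))

IsCharacteristic : ∀ {n} → Pred (Vec ℕ n) 0ℓ → (Vec ℕ n → ℕ) → Set
IsCharacteristic R χ = ∀ v → (R v × χ v ≡ 1) ⊎ (¬ R v × χ v ≡ 0)

RecursiveRel : ∀ {n} → Pred (Vec ℕ n) 0ℓ → Set
RecursiveRel R = ∃ λ χ → Recursive χ × IsCharacteristic R χ

module _ {n : ℕ} where

  private
    variable
      a b : Vec ℕ n → ℕ
      R Q : Pred (Vec ℕ n) 0ℓ

  ap₁ : (f : ℕ → ℕ) → Recursive₁ f → Recursive a → Recursive (λ v → f (a v))
  ap₁ {a = a} f F A = comp {g = λ _ → a} F (λ _ → A)

  ap₂ : (f : ℕ → ℕ → ℕ) → Recursive₂ f → Recursive a → Recursive b →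
        Recursive (λ v → f (a v) (b v))
  ap₂ {a = a} {b = b} f F A B =
    comp {g = λ { zero → a ; (suc _) → b }} F (λ { zero → A ; (suc _) → B })

  rel-⇔ : (∀ v → R v ⇔ Q v) → RecursiveRel R → RecursiveRel Q
  rel-⇔ R⇔Q (χ , r , c) = χ , r , λ v → [ (λ (p , e) → inj₁ (to (R⇔Q v) p , e))
                                        , (λ (p , e) → inj₂ (p ∘ from (R⇔Q v) , e)) ] (c v)

rec-suc : Recursive₁ suc
rec-suc = suc

rec-+ : Recursive₂ _+_
rec-+ = rec (proj zero) (ap₁ suc rec-suc (proj (suc zero))) (λ _ → refl) (λ _ _ → refl)

rec-* : Recursive₂ _*_
rec-* = rec (constant 0) (ap₂ _+_ rec-+ (proj (suc (suc zero))) (proj (suc zero)))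
  (λ _ → refl) (λ _ _ → refl)

rec-pred : Recursive₁ pred
rec-pred = rec (constant 0) (proj zero) (λ _ → refl) (λ _ _ → refl)

rec-∸ : Recursive₂ _∸_
rec-∸ = ap₂ (λ m n → n ∸ m)
  (rec (proj zero) (ap₁ pred rec-pred (proj (suc zero))) (λ _ → refl)
    (λ m v → sym (pred[m∸n]≡m∸[1+n] (lookup v zero) m)))
  (proj (suc zero)) (proj zero)

module _ {n : ℕ} where

  private
    variable
      a b : Vec ℕ n → ℕ
      R Q : Pred (Vec ℕ n) 0ℓ

  rel-≤ : Recursive a → Recursive b → RecursiveRel (λ v → a v ≤ b v)
  rel-≤ {a} {b} A B =
    (λ v → 1 ∸ (a v ∸ b v)) , ap₂ _∸_ rec-∸ (constant 1) (ap₂ _∸_ rec-∸ A B) , λ v → char (a v) (b v)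
    where
    char : ∀ x y → (x ≤ y × 1 ∸ (x ∸ y) ≡ 1) ⊎ (¬ x ≤ y × 1 ∸ (x ∸ y) ≡ 0)
    char x y with x ≤? y
    ... | yes x≤y = inj₁ (x≤y , cong (1 ∸_) (m≤n⇒m∸n≡0 x≤y))
    ... | no  x≰y = inj₂ (x≰y , m≤n⇒m∸n≡0 (m<n⇒0<n∸m (≰⇒> x≰y)))

  rel-< : Recursive a → Recursive b → RecursiveRel (λ v → a v < b v)
  rel-< A B = rel-≤ (ap₁ suc rec-suc A) B

  rel-∧ : RecursiveRel R → RecursiveRel Q → RecursiveRel (λ v → R v × Q v)
  rel-∧ {R} {Q} (χ , r , c) (ψ , s , d) = (λ v → χ v * ψ v) , ap₂ _*_ rec-* r s , char
    where
    char : IsCharacteristic (λ v → R v × Q v) (λ v → χ v * ψ v)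
    char v with c v | d v
    ... | inj₁ (p , e) | inj₁ (q , f) = inj₁ ((p , q) , cong₂ _*_ e f)
    ... | inj₁ (p , e) | inj₂ (q , f) = inj₂ (q ∘ proj₂ , cong₂ _*_ e f)
    ... | inj₂ (p , e) | _            = inj₂ (p ∘ proj₁ , cong (_* ψ v) e)

  rel-⇒ : RecursiveRel R → RecursiveRel Q → RecursiveRel (λ v → R v → Q v)
  rel-⇒ {R} {Q} (χ , r , c) (ψ , s , d) =
    (λ v → 1 ∸ (χ v ∸ ψ v)) , ap₂ _∸_ rec-∸ (constant 1) (ap₂ _∸_ rec-∸ r s) , char
    where
    char : IsCharacteristic (λ v → R v → Q v) (λ v → 1 ∸ (χ v ∸ ψ v))
    char v with c v | d v
    ... | inj₁ (p , e) | inj₁ (q , f) rewrite e | f = inj₁ (const q , refl)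
    ... | inj₁ (p , e) | inj₂ (q , f) rewrite e | f = inj₂ ((λ h → q (h p)) , refl)
    ... | inj₂ (p , e) | inj₁ (q , f) rewrite e | f = inj₁ (const q , refl)
    ... | inj₂ (p , e) | inj₂ (q , f) rewrite e | f = inj₁ ((λ x → contradiction x p) , refl)

  rel-≡ : Recursive a → Recursive b → RecursiveRel (λ v → a v ≡ b v)
  rel-≡ A B = rel-⇔ (λ v → mk⇔ (λ (p , q) → ≤-antisym p q) (λ e → ≤-reflexive e , ≤-reflexive (sym e)))
    (rel-∧ (rel-≤ A B) (rel-≤ B A))

  rel-∀< : {R : Pred (Vec ℕ (suc n)) 0ℓ} → Recursive b → RecursiveRel R →
           RecursiveRel (λ v → ∀ m → m < b v → R (m ∷ v))
  rel-∀< {b} {R} B (χ , r , c) =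
    (λ v → ψ (b v ∷ v)) ,
    ext (λ v → cong (λ w → ψ (b v ∷ w)) (tabulate-lookup v))
      (comp {f = ψ} {g = λ { zero → b ; (suc i) v → lookup v i }} rec-ψ (λ { zero → B ; (suc i) → proj i })) ,
    λ v → char v (b v)
    where
    open import Data.Vec.Properties using () renaming (tabulate∘lookup to tabulate-lookup)
    ψ : Vec ℕ (suc n) → ℕ
    ψ (zero  ∷ v) = 1
    ψ (suc k ∷ v) = ψ (k ∷ v) * χ (k ∷ v)
    rec-ψ : Recursive ψ
    rec-ψ = rec (constant 1)
      (ap₂ _*_ rec-* (proj (suc zero))
        (ext {g = λ { (m ∷ p ∷ v) → χ (m ∷ v) }} (λ { (m ∷ p ∷ v) → cong (λ w → χ (m ∷ w)) (tabulate-lookup v) })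
          (comp {f = χ} {g = λ { zero v → lookup v zero ; (suc i) v → lookup v (suc (suc i)) }} r
            (λ { zero → proj zero ; (suc i) → proj (suc (suc i)) }))))
      (λ _ → refl) (λ _ _ → refl)
    char : ∀ v k → ((∀ m → m < k → R (m ∷ v)) × ψ (k ∷ v) ≡ 1) ⊎
                   (¬ (∀ m → m < k → R (m ∷ v)) × ψ (k ∷ v) ≡ 0)
    char v zero = inj₁ ((λ _ ()) , refl)
    char v (suc k) with char v k | c (k ∷ v)
    ... | inj₂ (p , e) | _            = inj₂ ((λ h → p (λ m m<k → h m (m≤n⇒m≤1+n m<k))) , cong (_* χ (k ∷ v)) e)
    ... | inj₁ (p , e) | inj₂ (q , f) = inj₂ ((λ h → q (h k ≤-refl)) , cong₂ _*_ e f)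
    ... | inj₁ (p , e) | inj₁ (q , f) = inj₁ (all , cong₂ _*_ e f)
      where
      all : ∀ m → m < suc k → R (m ∷ v)
      all m m<1+k with m≤n⇒m<n∨m≡n (s≤s⁻¹ m<1+k)
      ... | inj₁ m<k  = p m m<k
      ... | inj₂ refl = q

rel-subst : ∀ {m n} {R : Pred (Vec ℕ m) 0ℓ} {g : Fin m → Vec ℕ n → ℕ} →
            RecursiveRel R → (∀ i → Recursive (g i)) →
            RecursiveRel (λ v → R (tabulate (λ i → g i v)))
rel-subst (χ , r , c) G = _ , comp r G , λ v → c _

-- The integer part of the square root: the second summand is 1 if (isqrt n + 1)² ≤ n + 1 and 0 otherwise.
isqrt : ℕ → ℕ
isqrt zero    = 0
isqrt (suc n) = isqrt n + (1 ∸ (suc (isqrt n) * suc (isqrt n) ∸ suc n))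

-- The pair (a , b) is coded by (a + b)² + b, so that 0 codes (0 , 0).
pair : ℕ → ℕ → ℕ
pair a b = (a + b) * (a + b) + b

π₁ π₂ : ℕ → ℕ
π₂ n = n ∸ isqrt n * isqrt n
π₁ n = isqrt n ∸ π₂ n

-- ⟪ i ⟫ n is usually written (i)ₙ.
⟪_⟫ : ℕ → ℕ → ℕ
⟪ i ⟫ n = π₁ (fold i π₂ n)

isqrt-spec : ∀ n → isqrt n * isqrt n ≤ n × n < suc (isqrt n) * suc (isqrt n)
isqrt-spec zero = z≤n , s≤s z≤n
isqrt-spec (suc n) with isqrt n | isqrt-spec n
... | s | lo , hi with suc s * suc s ≤? suc n
...   | yes le rewrite m≤n⇒m∸n≡0 le | +-comm s 1 =
        le , ≤-<-trans hi (*-mono-< {suc s} {suc (suc s)} ≤-refl ≤-refl)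
...   | no  gt rewrite m≤n⇒m∸n≡0 (m<n⇒0<n∸m (≰⇒> gt)) | +-identityʳ s =
        m≤n⇒m≤1+n lo , ≰⇒> gt

isqrt-unique : ∀ n s → s * s ≤ n → n < suc s * suc s → isqrt n ≡ s
isqrt-unique n s lo hi with isqrt-spec n
... | lo′ , hi′ = ≤-antisym (below (isqrt n) s (≤-<-trans lo′ hi)) (below s (isqrt n) (≤-<-trans lo hi′))
  where
  below : ∀ a b → a * a < suc b * suc b → a ≤ b
  below a b lt = ≮⇒≥ λ b<a → <⇒≱ lt (*-mono-≤ b<a b<a)

isqrt-pair : ∀ a b → isqrt (pair a b) ≡ a + b
isqrt-pair a b = isqrt-unique (pair a b) (a + b) (m≤m+n _ b) (begin-strict
  s * s + b        ≤⟨ +-monoʳ-≤ (s * s) (m≤n+m b a) ⟩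
  s * s + s        ≡⟨ +-comm (s * s) s ⟩
  s + s * s        ≡⟨ *-suc s s ⟨
  s * suc s        <⟨ *-monoˡ-< (suc s) (n<1+n s) ⟩
  suc s * suc s    ∎)
  where
  open ≤-Reasoning
  s = a + b

π₂-pair : ∀ a b → π₂ (pair a b) ≡ b
π₂-pair a b rewrite isqrt-pair a b = m+n∸m≡n ((a + b) * (a + b)) b

π₁-pair : ∀ a b → π₁ (pair a b) ≡ a
π₁-pair a b rewrite π₂-pair a b | isqrt-pair a b = m+n∸n≡m a b

π₂-≤ : ∀ n → π₂ n ≤ pred n
π₂-≤ zero = z≤n
π₂-≤ (suc n) with isqrt (suc n) | isqrt-spec (suc n)
... | zero  | _ , s≤s ()
... | suc s | _ , _ = m∸n≤m n (s + s * suc s)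

code : (ℕ → ℕ) → ℕ → ℕ
code α zero    = 0
code α (suc k) = pair (α 0) (code (α ∘ suc) k)

fold-shift : ∀ i n → fold i π₂ (suc n) ≡ fold (π₂ i) π₂ n
fold-shift i zero    = refl
fold-shift i (suc n) = cong π₂ (fold-shift i n)

⟪code⟫ : ∀ α k n → n < k → ⟪ code α k ⟫ n ≡ α n
⟪code⟫ α (suc k) zero    _     = π₁-pair (α 0) _
⟪code⟫ α (suc k) (suc n) n<k = begin
  π₁ (fold (code α (suc k)) π₂ (suc n))   ≡⟨ cong π₁ (fold-shift (code α (suc k)) n) ⟩
  ⟪ π₂ (code α (suc k)) ⟫ n              ≡⟨ cong (λ i → ⟪ i ⟫ n) (π₂-pair (α 0) _) ⟩
  ⟪ code (α ∘ suc) k ⟫ n                 ≡⟨ ⟪code⟫ (α ∘ suc) k n (s≤s⁻¹ n<k) ⟩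
  α (suc n)                              ∎
  where open ≡-Reasoning

⟪⟫-zero : ∀ i n → i ≤ n → ⟪ i ⟫ n ≡ 0
⟪⟫-zero i n i≤n = cong π₁ (n≤0⇒n≡0 (≤-trans (bound n) (≤-reflexive (m≤n⇒m∸n≡0 i≤n))))
  where
  bound : ∀ n → fold i π₂ n ≤ i ∸ n
  bound zero    = ≤-refl
  bound (suc n) = ≤-trans (π₂-≤ (fold i π₂ n)) (≤-trans (pred-mono-≤ (bound n)) (≤-reflexive (pred[m∸n]≡m∸[1+n] i n)))

rec-isqrt : Recursive₁ isqrt
rec-isqrt = rec (constant 0)
  (ap₂ _+_ rec-+ (proj (suc zero)) (ap₂ _∸_ rec-∸ (constant 1) (ap₂ _∸_ rec-∸
    (ap₂ _*_ rec-* (ap₁ suc rec-suc (proj (suc zero))) (ap₁ suc rec-suc (proj (suc zero))))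
    (ap₁ suc rec-suc (proj zero)))))
  (λ _ → refl) (λ _ _ → refl)

rec-π₂ : Recursive₁ π₂
rec-π₂ = ap₂ _∸_ rec-∸ (proj zero) (ap₂ _*_ rec-* rec-isqrt rec-isqrt)

rec-π₁ : Recursive₁ π₁
rec-π₁ = ap₂ _∸_ rec-∸ rec-isqrt rec-π₂

rec-⟪⟫ : Recursive₂ ⟪_⟫
rec-⟪⟫ = ap₁ π₁ rec-π₁ (ap₂ (λ n i → fold i π₂ n)
  (rec (proj zero) (ap₁ π₂ rec-π₂ (proj (suc zero))) (λ _ → refl) (λ _ _ → refl))
  (proj (suc zero)) (proj zero))

record ℝ : Set₁ where
  field
    L U         : Pred ℚᵘ 0ℓ
    L-inhabited : ∃ L
    U-inhabited : ∃ U
    L-rounded   : ∀ q → L q ⇔ ∃ λ r → q ℚ.< r × L r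
    U-rounded   : ∀ q → U q ⇔ ∃ λ r → r ℚ.< q × U r
    disjoint    : ∀ q → L q → ¬ U q
    located     : ∀ {p q} → p ℚ.< q → L p ⊎ U q

infix 4 _<ᵣ_ _≤ᵣ_ _≤ℝ_

_<ᵣ_ _≤ᵣ_ : ℝ → ℚᵘ → Set
x <ᵣ q = ℝ.U x q
x ≤ᵣ q = ¬ ℝ.L x q

_≤ℝ_ : ℝ → ℝ → Set
x ≤ℝ y = ∀ q → y <ᵣ q → x <ᵣ q

-- m/(k+1)
frac : ℕ → ℕ → ℚᵘ
frac m k = mkℚᵘ (+ m) k

frac-≤⁺ : ∀ {m k n l} → m * suc l ≤ n * suc k → frac m k ℚ.≤ frac n l
frac-≤⁺ {m} {k} {n} {l} le =
  *≤* (subst₂ ℤ._≤_ (ℤ.pos-* m (suc l)) (ℤ.pos-* n (suc k)) (ℤ.+≤+ le))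

frac-≤⁻ : ∀ {m k n l} → frac m k ℚ.≤ frac n l → m * suc l ≤ n * suc k
frac-≤⁻ {m} {k} {n} {l} (*≤* le) =
  ℤ.drop‿+≤+ (subst₂ ℤ._≤_ (sym (ℤ.pos-* m (suc l))) (sym (ℤ.pos-* n (suc k))) le)

frac-<⁺ : ∀ {m k n l} → m * suc l < n * suc k → frac m k ℚ.< frac n l
frac-<⁺ lt = ℚ.≰⇒> (<⇒≱ lt ∘ frac-≤⁻)

frac-<⁻ : ∀ {m k n l} → frac m k ℚ.< frac n l → m * suc l < n * suc k
frac-<⁻ lt = ≰⇒> (ℚ.<⇒≱ lt ∘ frac-≤⁺)

below : ∀ q → ∃ λ r → r ℚ.< q
below q = q ℚ.- 1ℚᵘ , subst (q ℚ.- 1ℚᵘ ℚ.<_) (ℚ.+-identityʳ-≡ q) (ℚ.+-monoʳ-< q (*<* ℤ.-<+))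

-- The lower cut omits the greatest rational outside U, if there is one.
fromUpper : (U : Pred ℚᵘ 0ℓ) → Decidable U → ∃ U → (∃ λ q → ¬ U q) →
            (∀ q → U q ⇔ ∃ λ r → r ℚ.< q × U r) → ℝ
fromUpper U U? u (q₀ , ¬u) rounded = record
  { L           = λ q → ∃ λ r → q ℚ.< r × ¬ U r
  ; U           = U
  ; L-inhabited = proj₁ (below q₀) , q₀ , proj₂ (below q₀) , ¬u
  ; U-inhabited = u
  ; L-rounded   = λ q → mk⇔
      (λ (r , q<r , ¬Ur) → let (s , q<s , s<r) = ℚ.<-dense q<r in s , q<s , r , s<r , ¬Ur)
      (λ (s , q<s , r , s<r , ¬Ur) → r , ℚ.<-trans q<s s<r , ¬Ur)
  ; U-rounded   = rounded
  ; disjoint    = λ q (r , q<r , ¬Ur) Uq → ¬Ur (from (rounded r) (q , q<r , Uq))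
  ; located     = loc
  }
  where
  loc : ∀ {p q} → p ℚ.< q → (∃ λ r → p ℚ.< r × ¬ U r) ⊎ U q
  loc {q = q} p<q with U? q
  ... | yes Uq = inj₂ Uq
  ... | no ¬Uq = inj₁ (q , p<q , ¬Uq)

fromℚ : ℚᵘ → ℝ
fromℚ q = fromUpper (q ℚ.<_) (q ℚ.<?_)
  (q ℚ.+ 1ℚᵘ , subst (ℚ._< q ℚ.+ 1ℚᵘ) (ℚ.+-identityʳ-≡ q) (ℚ.+-monoʳ-< q (*<* (ℤ.+<+ (s≤s z≤n)))))
  (q , ℚ.<-irrefl ℚ.≃-refl)
  (λ r → mk⇔ (λ q<r → let (s , q<s , s<r) = ℚ.<-dense q<r in s , s<r , q<s)
             (λ (s , s<r , q<s) → ℚ.<-trans q<s s<r))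

U-mono : ∀ x {p q} → p ℚ.< q → x <ᵣ p → x <ᵣ q
U-mono x {p} {q} p<q u = from (ℝ.U-rounded x q) (p , p<q , u)

_⊔ℝ_ : ℝ → ℝ → ℝ
x ⊔ℝ y = record
  { L           = λ q → X.L q ⊎ Y.L q
  ; U           = λ q → X.U q × Y.U q
  ; L-inhabited = let (q , l) = X.L-inhabited in q , inj₁ l
  ; U-inhabited = U-inh
  ; L-rounded   = λ q → mk⇔
      [ (λ l → let (r , q<r , l′) = to (X.L-rounded q) l in r , q<r , inj₁ l′)
      , (λ l → let (r , q<r , l′) = to (Y.L-rounded q) l in r , q<r , inj₂ l′) ]
      (λ { (r , q<r , inj₁ l) → inj₁ (from (X.L-rounded q) (r , q<r , l))
         ; (r , q<r , inj₂ l) → inj₂ (from (Y.L-rounded q) (r , q<r , l)) })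
  ; U-rounded   = λ q → mk⇔ U-below
      (λ (r , r<q , u , v) → U-mono x r<q u , U-mono y r<q v)
  ; disjoint    = λ q → [ (λ l (u , _) → X.disjoint q l u) , (λ l (_ , v) → Y.disjoint q l v) ]
  ; located     = loc
  }
  where
  module X = ℝ x
  module Y = ℝ y
  U-mono≤ : ∀ z {p q} → p ℚ.≤ q → z <ᵣ p → z <ᵣ q
  U-mono≤ z {p} p≤q u = let (r , r<p , u′) = to (ℝ.U-rounded z p) u in U-mono z (ℚ.<-≤-trans r<p p≤q) u′
  U-inh : ∃ λ q → X.U q × Y.U q
  U-inh with X.U-inhabited | Y.U-inhabited
  ... | p , u | q , v with ℚ.≤-total p q
  ...   | inj₁ p≤q = q , U-mono≤ x p≤q u , v
  ...   | inj₂ q≤p = p , u , U-mono≤ y q≤p v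
  U-below : ∀ {q} → X.U q × Y.U q → ∃ λ r → r ℚ.< q × X.U r × Y.U r
  U-below {q} (u , v) with to (X.U-rounded q) u | to (Y.U-rounded q) v
  ... | r , r<q , u′ | s , s<q , v′ with ℚ.≤-total r s
  ...   | inj₁ r≤s = s , s<q , U-mono≤ x r≤s u′ , v′
  ...   | inj₂ s≤r = r , r<q , u′ , U-mono≤ y s≤r v′
  loc : ∀ {p q} → p ℚ.< q → (X.L p ⊎ Y.L p) ⊎ (X.U q × Y.U q)
  loc p<q with X.located p<q | Y.located p<q
  ... | inj₁ l | _      = inj₁ (inj₁ l)
  ... | inj₂ _ | inj₁ l = inj₁ (inj₂ l)
  ... | inj₂ u | inj₂ v = inj₂ (u , v)

record RecPolish : Set₁ where
  infix 4 _≈_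
  field
    Carrier    : Set
    _≈_        : Carrier → Carrier → Set
    d          : Carrier → Carrier → ℝ
    nonneg     : ∀ x y → fromℚ 0ℚᵘ ≤ℝ d x y
    zero-dist  : ∀ x y → x ≈ y ⇔ d x y ≤ᵣ 0ℚᵘ
    symmetric  : ∀ x y → d x y ≤ℝ d y x
    triangle   : ∀ x y z p q → d x y <ᵣ p → d y z <ᵣ q → d x z <ᵣ p ℚ.+ q

  Cauchy : (ℕ → Carrier) → Set
  Cauchy s = ∀ ε → 0ℚᵘ ℚ.< ε → ∃ λ K → ∀ m n → K ≤ m → K ≤ n → d (s m) (s n) <ᵣ ε

  _⟶_ : (ℕ → Carrier) → Carrier → Set
  s ⟶ x = ∀ ε → 0ℚᵘ ℚ.< ε → ∃ λ K → ∀ n → K ≤ n → d (s n) x <ᵣ ε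

  field
    complete   : ∀ s → Cauchy s → ∃ λ x → s ⟶ x
    r          : ℕ → Carrier
    dense      : ∀ x ε → 0ℚᵘ ℚ.< ε → ∃ λ i → d x (r i) <ᵣ ε
    ≤-recursive : RecursiveRel {4} λ { (i ∷ j ∷ m ∷ k ∷ []) → d (r i) (r j) ≤ᵣ frac m k }
    <-recursive : RecursiveRel {4} λ { (i ∷ j ∷ m ∷ k ∷ []) → d (r i) (r j) <ᵣ frac m k }

open RecPolish public using () renaming (Carrier to ∣_∣)

private
  v₀ v₁ v₂ v₃ : Vec ℕ 4 → ℕ
  v₀ v = lookup v zero
  v₁ v = lookup v (suc zero)
  v₂ v = lookup v (suc (suc zero))
  v₃ v = lookup v (suc (suc (suc zero)))

-- ω carries the metric with d(m,n) = 1 for m ≠ n.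
ω : RecPolish
ω = record
  { Carrier     = ℕ
  ; _≈_         = _≡_
  ; d           = λ m n → fromℚ (δ m n)
  ; nonneg      = λ m n q δ<q → ℚ.≤-<-trans (δ≥0 m n) δ<q
  ; zero-dist   = zd
  ; symmetric   = λ m n q → subst (ℚ._< q) (δ-sym n m)
  ; triangle    = tri
  ; complete    = λ s c → let (K , near) = c 1ℚᵘ 0<1 in
      s K , λ ε 0<ε → K , λ n K≤n → subst (λ x → δ (s n) x ℚ.< ε)
        (δ<1 (s n) (s K) (near n K K≤n ≤-refl)) (subst (ℚ._< ε) (sym (δ-refl (s n))) 0<ε)
  ; r           = id
  ; dense       = λ x ε 0<ε → x , subst (ℚ._< ε) (sym (δ-refl x)) 0<ε
  ; ≤-recursive = rel-⇔ (λ { (i ∷ j ∷ m ∷ k ∷ []) → le i j m k })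
      (rel-⇒ (rel-⇒ (rel-≡ (proj zero) (proj (suc zero))) (rel-< (constant 0) (constant 0)))
             (rel-< (proj (suc (suc (suc zero)))) (proj (suc (suc zero)))))
  ; <-recursive = rel-⇔ (λ { (i ∷ j ∷ m ∷ k ∷ []) → lt i j m k })
      (rel-∧ (rel-< (constant 0) (proj (suc (suc zero))))
        (rel-⇒ (rel-⇒ (rel-≡ (proj zero) (proj (suc zero))) (rel-< (constant 0) (constant 0)))
               (rel-< (ap₁ suc rec-suc (proj (suc (suc (suc zero))))) (proj (suc (suc zero))))))
  }
  where
  0<1 : 0ℚᵘ ℚ.< 1ℚᵘ
  0<1 = *<* (ℤ.+<+ (s≤s z≤n))
  δ : ℕ → ℕ → ℚᵘ
  δ m n with m ≟ n
  ... | yes _ = 0ℚᵘ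
  ... | no  _ = 1ℚᵘ
  δ-refl : ∀ m → δ m m ≡ 0ℚᵘ
  δ-refl m with m ≟ m
  ... | yes _ = refl
  ... | no ¬e = contradiction refl ¬e
  δ≥0 : ∀ m n → 0ℚᵘ ℚ.≤ δ m n
  δ≥0 m n with m ≟ n
  ... | yes _ = ℚ.≤-refl
  ... | no  _ = ℚ.<⇒≤ 0<1
  δ-sym : ∀ m n → δ m n ≡ δ n m
  δ-sym m n with m ≟ n | n ≟ m
  ... | yes _ | yes _ = refl
  ... | no  _ | no  _ = refl
  ... | yes e | no ¬e = contradiction (sym e) ¬e
  ... | no ¬e | yes e = contradiction (sym e) ¬e
  δ<1 : ∀ m n → δ m n ℚ.< 1ℚᵘ → m ≡ n
  δ<1 m n lt with m ≟ n
  ... | yes e = e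
  ... | no  _ = contradiction lt (ℚ.<-irrefl ℚ.≃-refl)
  zd : ∀ m n → m ≡ n ⇔ fromℚ (δ m n) ≤ᵣ 0ℚᵘ
  zd m n with m ≟ n
  ... | yes e = mk⇔ (λ _ (r , 0<r , r≤0) → r≤0 0<r) (const e)
  ... | no ¬e = mk⇔ (λ e → contradiction e ¬e)
                    (λ h → contradiction (1ℚᵘ , 0<1 , ℚ.<-irrefl ℚ.≃-refl) h)
  tri : ∀ x y z p q → δ x y ℚ.< p → δ y z ℚ.< q → δ x z ℚ.< p ℚ.+ q
  tri x y z p q a b with x ≟ z
  ... | yes _ = ℚ.+-mono-< {0ℚᵘ} (ℚ.≤-<-trans (δ≥0 x y) a) (ℚ.≤-<-trans (δ≥0 y z) b)
  ... | no x≢z with x ≟ y | y ≟ z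
  ...   | yes e | yes f = contradiction (trans e f) x≢z
  ...   | no _  | yes _ = ℚ.+-mono-< a b
  ...   | yes _ | no _  = ℚ.+-mono-< a b
  ...   | no _  | no _  = ℚ.+-mono-< {0ℚᵘ} (ℚ.<-trans 0<1 a) b
  δ≤ : ∀ i j q → fromℚ (δ i j) ≤ᵣ q ⇔ δ i j ℚ.≤ q
  δ≤ i j q = mk⇔ (λ h → ℚ.≮⇒≥ λ q<δ → h (δ i j , q<δ , ℚ.<-irrefl ℚ.≃-refl)) g
    where
    g : δ i j ℚ.≤ q → fromℚ (δ i j) ≤ᵣ q
    g δ≤q (r , q<r , ¬δ<r) = ¬δ<r (ℚ.≤-<-trans δ≤q q<r)
  le : ∀ i j m k → (((i ≡ j → 0 < 0) → k < m)) ⇔ fromℚ (δ i j) ≤ᵣ frac m k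
  le i j m k = mk⇔ (from (δ≤ i j _) ∘ f) (g ∘ to (δ≤ i j _))
    where
    f : ((i ≡ j → 0 < 0) → k < m) → δ i j ℚ.≤ frac m k
    f h with i ≟ j
    ... | yes _ = frac-≤⁺ {0} {0} z≤n
    ... | no ¬e = frac-≤⁺ {1} {0} (subst₂ _≤_ (sym (*-identityˡ (suc k))) (sym (*-identityʳ m)) (h (λ e → contradiction e ¬e)))
    g : δ i j ℚ.≤ frac m k → (i ≡ j → 0 < 0) → k < m
    g le ¬e with i ≟ j
    ... | yes e = contradiction (¬e e) (<-irrefl refl)
    ... | no _  = subst₂ _≤_ (*-identityˡ (suc k)) (*-identityʳ m) (frac-≤⁻ {1} {0} le)
  lt : ∀ i j m k → (0 < m × ((i ≡ j → 0 < 0) → suc k < m)) ⇔ fromℚ (δ i j) <ᵣ frac m k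
  lt i j m k = mk⇔ f g
    where
    f : (0 < m × ((i ≡ j → 0 < 0) → suc k < m)) → δ i j ℚ.< frac m k
    f (0<m , h) with i ≟ j
    ... | yes _ = frac-<⁺ {0} {0} (subst (0 <_) (sym (*-identityʳ m)) 0<m)
    ... | no ¬e = frac-<⁺ {1} {0} (subst₂ _<_ (sym (*-identityˡ (suc k))) (sym (*-identityʳ m)) (h (λ e → contradiction e ¬e)))
    g : δ i j ℚ.< frac m k → 0 < m × ((i ≡ j → 0 < 0) → suc k < m)
    g lt with i ≟ j
    ... | yes e = subst (0 <_) (*-identityʳ m) (frac-<⁻ {0} {0} lt) , λ ¬e → contradiction (¬e e) (<-irrefl refl)
    ... | no _  = <-trans (s≤s z≤n) 1+k<m , const 1+k<m
      where 1+k<m = subst₂ _<_ (*-identityˡ (suc k)) (*-identityʳ m) (frac-<⁻ {1} {0} lt)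

frac-antitone : ∀ {m n} → m ≤ n → frac 1 n ℚ.≤ frac 1 m
frac-antitone {m} {n} m≤n = frac-≤⁺ {1} {n} (*-monoʳ-≤ 1 (s≤s m≤n))

frac-pos : ∀ m k → 0ℚᵘ ℚ.< frac (suc m) k
frac-pos m k = frac-<⁺ {0} {0} (s≤s z≤n)

archimedean : ∀ q → 0ℚᵘ ℚ.< q → ∃ λ n → ∀ m → q ℚ.≤ frac 1 m → m < n
archimedean (mkℚᵘ (+ zero)  k) (*<* (ℤ.+<+ ()))
archimedean (mkℚᵘ -[1+ _ ]  k) (*<* ())
archimedean (mkℚᵘ (+ suc n) k) _ = suc k , λ m q≤ → s≤s⁻¹ (s≤s (begin
  suc m            ≤⟨ m≤m+n (suc m) (n * suc m) ⟩
  suc n * suc m    ≤⟨ frac-≤⁻ {suc n} q≤ ⟩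
  1 * suc k        ≡⟨ *-identityˡ (suc k) ⟩
  suc k            ∎))
  where open ≤-Reasoning

least : {P : Pred ℕ 0ℓ} → Decidable P → ∀ n → P n → ∃ λ k → P k × ∀ m → m < k → ¬ P m
least {P} P? n p with search n
  where
  search : ∀ n → (∃ λ k → P k × ∀ m → m < k → ¬ P m) ⊎ (∀ m → m < n → ¬ P m)
  search zero = inj₂ λ _ ()
  search (suc n) with search n
  ... | inj₁ found = inj₁ found
  ... | inj₂ none with P? n
  ...   | yes p = inj₁ (n , p , none)
  ...   | no ¬p = inj₂ λ m m<1+n → [ none m , (λ { refl → ¬p }) ] (m≤n⇒m<n∨m≡n (s≤s⁻¹ m<1+n))
... | inj₁ found = found
... | inj₂ none = n , p , none

-- The space of sequences in a discrete set A, where ι embeds A in ω with left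
-- inverse κ.
module Sequences {A : Set} (ι : A → ℕ) (κ : ℕ → A)
                 (κ∘ι : ∀ a → κ (ι a) ≡ a) (rec-ικ : Recursive₁ (ι ∘ κ)) where

  ι-injective : ∀ {a b} → ι a ≡ ι b → a ≡ b
  ι-injective {a} {b} e = trans (sym (κ∘ι a)) (trans (cong κ e) (κ∘ι b))

  _≟ᴬ_ : (a b : A) → Dec (a ≡ b)
  a ≟ᴬ b = Dec.map′ ι-injective (cong ι) (ι a ≟ ι b)

  -- d(α,β) = 1/(n+1) for the least n with α(n) ≠ β(n), and d(α,β) = 0 if α = β;
  -- hence d(α,β) < q iff q > 0 and no n with q ≤ 1/(n+1) has α(n) ≠ β(n).
  Near : (α β : ℕ → A) → Pred ℚᵘ 0ℓ
  Near α β q = 0ℚᵘ ℚ.< q × ∀ n → q ℚ.≤ frac 1 n → α n ≡ β n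

  Near? : ∀ α β → Decidable (Near α β)
  Near? α β q with 0ℚᵘ ℚ.<? q
  ... | no ¬0<q = no (¬0<q ∘ proj₁)
  ... | yes 0<q with archimedean q 0<q
  ...   | K , <K with allUpTo? (λ n → dec n) K
    where
    dec : ∀ n → Dec (q ℚ.≤ frac 1 n → α n ≡ β n)
    dec n with α n ≟ᴬ β n | q ℚ.≤? frac 1 n
    ... | yes e | _      = yes (const e)
    ... | no ¬e | yes le = no (λ h → ¬e (h le))
    ... | no ¬e | no ¬le = yes (λ le → contradiction le ¬le)
  ...     | yes h = yes (0<q , λ n le → h (<K n le) le)
  ...     | no ¬h = no λ (_ , h) → ¬h (λ {n} _ → h n)

  Near-rounded : ∀ α β q → Near α β q ⇔ ∃ λ r → r ℚ.< q × Near α β r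
  Near-rounded α β q = mk⇔ f g
    where
    f : Near α β q → ∃ λ r → r ℚ.< q × Near α β r
    f (0<q , h) with archimedean q 0<q
    ... | K , <K with least (λ n → frac 1 n ℚ.<? q) K (ℚ.≰⇒> λ q≤ → <-irrefl refl (<K K q≤))
    ...   | n , n∈ , first with ℚ.<-dense n∈
    ...     | r , <r , r<q = r , r<q , ℚ.<-trans (frac-pos 0 n) <r , λ m r≤ →
      h m (ℚ.≮⇒≥ (first m (≰⇒> λ n≤m → ℚ.<⇒≱ <r (ℚ.≤-trans r≤ (frac-antitone n≤m)))))
    g : (∃ λ r → r ℚ.< q × Near α β r) → Near α β q
    g (r , r<q , 0<r , h) = ℚ.<-trans 0<r r<q , λ n q≤ → h n (ℚ.≤-trans (ℚ.<⇒≤ r<q) q≤)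

  dist : (α β : ℕ → A) → ℝ
  dist α β = fromUpper (Near α β) (Near? α β)
    (frac 2 0 , frac-pos 1 0 , λ n le → contradiction (frac-≤⁻ {2} {0} {1} {n} le) (<⇒≱ (s≤s (≤-trans (s≤s z≤n) (m≤n+m _ n)))))
    (0ℚᵘ , ℚ.<-irrefl ℚ.≃-refl ∘ proj₁)
    (Near-rounded α β)

  dist-≤⁺ : ∀ {α β} q → (∀ r → q ℚ.< r → Near α β r) → dist α β ≤ᵣ q
  dist-≤⁺ q h (r , q<r , ¬near) = ¬near (h r q<r)

  dist-≤⁻ : ∀ {α β} q → dist α β ≤ᵣ q → ∀ n → q ℚ.< frac 1 n → α n ≡ β n
  dist-≤⁻ {α} {β} q h n q< with α n ≟ᴬ β n
  ... | yes e = e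
  ... | no ¬e = contradiction (frac 1 n , q< , λ (_ , near) → ¬e (near n ℚ.≤-refl)) h

  max : (ℕ → ℕ) → ℕ → ℕ
  max f zero    = 0
  max f (suc n) = max f n ⊔ f n

  max-≤ : ∀ f n m → m < n → f m ≤ max f n
  max-≤ f (suc n) m m<1+n with m≤n⇒m<n∨m≡n (s≤s⁻¹ m<1+n)
  ... | inj₁ m<n  = ≤-trans (max-≤ f n m m<n) (m≤m⊔n (max f n) (f n))
  ... | inj₂ refl = m≤n⊔m (max f n) (f n)

  rec-ικ⟪⟫ : ∀ i → RecursiveRel λ v → ι (κ (⟪ lookup v (suc zero) ⟫ (lookup v zero)))
                                      ≡ ι (κ (⟪ lookup {n = 5} v i ⟫ (lookup v zero)))
  rec-ικ⟪⟫ i = rel-≡ (ap₁ (ι ∘ κ) rec-ικ (ap₂ ⟪_⟫ rec-⟪⟫ (proj (suc zero)) (proj zero)))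
                    (ap₁ (ι ∘ κ) rec-ικ (ap₂ ⟪_⟫ rec-⟪⟫ (proj i) (proj zero)))

  agree : ∀ i j {P : ℕ → Set} → (∀ n → n < i + j → P n → ι (κ (⟪ i ⟫ n)) ≡ ι (κ (⟪ j ⟫ n))) →
          ∀ n → P n → κ (⟪ i ⟫ n) ≡ κ (⟪ j ⟫ n)
  agree i j h n p with n <? i + j
  ... | yes n< = ι-injective (h n n< p)
  ... | no ¬n< = cong κ (trans (⟪⟫-zero i n (m+n≤o⇒m≤o i (≮⇒≥ ¬n<)))
                        (sym (⟪⟫-zero j n (m+n≤o⇒n≤o i (≮⇒≥ ¬n<)))))

  space : RecPolish
  space = record
    { Carrier     = ℕ → A
    ; _≈_         = _≗_
    ; d           = dist
    ; nonneg      = λ α β q → proj₁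
    ; zero-dist   = λ α β → mk⇔ (λ e → dist-≤⁺ 0ℚᵘ λ r 0<r → 0<r , λ n _ → e n)
                                (λ h n → dist-≤⁻ 0ℚᵘ h n (frac-pos 0 n))
    ; symmetric   = λ α β q (0<q , h) → 0<q , λ n q≤ → sym (h n q≤)
    ; triangle    = λ α β γ p q (0<p , h) (0<q , h′) →
        ℚ.+-mono-< {0ℚᵘ} 0<p 0<q , λ n p+q≤ → trans
          (h n (ℚ.≤-trans (ℚ.<⇒≤ (subst (ℚ._< p ℚ.+ q) (ℚ.+-identityʳ-≡ p) (ℚ.+-monoʳ-< p 0<q))) p+q≤))
          (h′ n (ℚ.≤-trans (ℚ.<⇒≤ (subst (ℚ._< p ℚ.+ q) (ℚ.+-identityˡ-≡ q) (ℚ.+-monoˡ-< q 0<p))) p+q≤))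
    ; complete    = λ s c →
        let K n = proj₁ (c (frac 1 n) (frac-pos 0 n))
            x n = s (K n) n
            near n m K≤m = proj₂ (proj₂ (c (frac 1 n) (frac-pos 0 n)) m (K n) K≤m ≤-refl) n ℚ.≤-refl
        in x , λ ε 0<ε → let (B , <B) = archimedean ε 0<ε in
          max K B , λ m maxK≤m → 0<ε , λ n ε≤ → near n m (≤-trans (max-≤ K B n (<B n ε≤)) maxK≤m)
    ; r           = λ i n → κ (⟪ i ⟫ n)
    ; dense       = λ α ε 0<ε → let (K , <K) = archimedean ε 0<ε in
        code (ι ∘ α) K , 0<ε , λ n ε≤ →
          sym (trans (cong κ (⟪code⟫ (ι ∘ α) K n (<K n ε≤))) (κ∘ι (α n)))
    ; ≤-recursive = rel-⇔ (λ { (i ∷ j ∷ m ∷ k ∷ []) → le i j m k })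
        (rel-∀< i+j (rel-⇒ (rel-< m*[n+1] k+1) (rec-ικ⟪⟫ (suc (suc zero)))))
    ; <-recursive = rel-⇔ (λ { (i ∷ j ∷ m ∷ k ∷ []) → lt i j m k })
        (rel-∧ (rel-< (constant 0) (proj (suc (suc zero))))
          (rel-∀< i+j (rel-⇒ (rel-≤ m*[n+1] k+1) (rec-ικ⟪⟫ (suc (suc zero))))))
    }
    where
    i+j : Recursive {4} (λ v → lookup v zero + lookup v (suc zero))
    i+j = ap₂ _+_ rec-+ (proj zero) (proj (suc zero))
    m*[n+1] : Recursive {5} (λ v → lookup v (suc (suc (suc zero))) * suc (lookup v zero))
    m*[n+1] = ap₂ _*_ rec-* (proj _) (ap₁ suc rec-suc (proj zero))
    k+1 : Recursive {5} (λ v → 1 * suc (lookup v (suc (suc (suc (suc zero))))))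
    k+1 = ap₂ _*_ rec-* (constant 1) (ap₁ suc rec-suc (proj _))
    le : ∀ i j m k →
         (∀ n → n < i + j → m * suc n < 1 * suc k → ι (κ (⟪ i ⟫ n)) ≡ ι (κ (⟪ j ⟫ n))) ⇔
         dist (λ n → κ (⟪ i ⟫ n)) (λ n → κ (⟪ j ⟫ n)) ≤ᵣ frac m k
    le i j m k = mk⇔
      (λ h → dist-≤⁺ (frac m k) λ r q<r → ℚ.≤-<-trans (frac-≤⁺ {0} {0} z≤n) q<r , λ n r≤ →
        agree i j h n (frac-<⁻ {m} (ℚ.<-≤-trans q<r r≤)))
      (λ h n _ lt → cong ι (dist-≤⁻ (frac m k) h n (frac-<⁺ {m} lt)))
    lt : ∀ i j m k →
         (0 < m × (∀ n → n < i + j → m * suc n ≤ 1 * suc k → ι (κ (⟪ i ⟫ n)) ≡ ι (κ (⟪ j ⟫ n)))) ⇔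
         dist (λ n → κ (⟪ i ⟫ n)) (λ n → κ (⟪ j ⟫ n)) <ᵣ frac m k
    lt i j m k = mk⇔
      (λ (0<m , h) → frac-<⁺ {0} {0} (subst (0 <_) (sym (*-identityʳ m)) 0<m) ,
                     λ n q≤ → agree i j h n (frac-≤⁻ {m} q≤))
      (λ (0<q , h) → subst (0 <_) (*-identityʳ m) (frac-<⁻ {0} {0} {m} {k} 0<q) ,
                     λ n _ le → cong ι (h n (frac-≤⁺ {m} le)))

ω^ω : RecPolish
ω^ω = Sequences.space id id (λ _ → refl) (proj zero)

2^ω : RecPolish
2^ω = Sequences.space ι κ (λ { false → refl ; true → refl })
  (rec (constant 0) (constant 1) (λ _ → refl) (λ _ _ → refl))
  where
  ι : Bool → ℕ
  ι false = 0
  ι true  = 1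
  κ : ℕ → Bool
  κ zero    = false
  κ (suc _) = true

infixr 2 _⊗_

-- The product has the maximum metric, so its balls are products of balls of the
-- same radius; its dense sequence runs through all pairs of dense points.

_⊗_ : RecPolish → RecPolish → RecPolish
X ⊗ Y = record
  { Carrier     = ∣ X ∣ × ∣ Y ∣
  ; _≈_         = λ (x , y) (x′ , y′) → x X.≈ x′ × y Y.≈ y′
  ; d           = λ (x , y) (x′ , y′) → X.d x x′ ⊔ℝ Y.d y y′
  ; nonneg      = λ (x , _) (x′ , _) q (u , _) → X.nonneg x x′ q u
  ; zero-dist   = λ (x , y) (x′ , y′) → mk⇔
      (λ (e , f) → [ to (X.zero-dist x x′) e , to (Y.zero-dist y y′) f ])
      (λ h → from (X.zero-dist x x′) (h ∘ inj₁) , from (Y.zero-dist y y′) (h ∘ inj₂))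
  ; symmetric   = λ (x , y) (x′ , y′) q (u , v) → X.symmetric x x′ q u , Y.symmetric y y′ q v
  ; triangle    = λ (x , y) (x′ , y′) (x″ , y″) p q (u , v) (u′ , v′) →
      X.triangle x x′ x″ p q u u′ , Y.triangle y y′ y″ p q v v′
  ; complete    = λ s c →
      let (x , s⟶x) = X.complete (proj₁ ∘ s) (λ ε 0<ε → let (K , h) = c ε 0<ε in
                        K , λ m n K≤m K≤n → proj₁ (h m n K≤m K≤n))
          (y , s⟶y) = Y.complete (proj₂ ∘ s) (λ ε 0<ε → let (K , h) = c ε 0<ε in
                        K , λ m n K≤m K≤n → proj₂ (h m n K≤m K≤n))
      in (x , y) , λ ε 0<ε → let (K , h) = s⟶x ε 0<ε ; (M , k) = s⟶y ε 0<ε in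
        K ⊔ M , λ n K⊔M≤n → h n (m⊔n≤o⇒m≤o K M K⊔M≤n) , k n (m⊔n≤o⇒n≤o K M K⊔M≤n)
  ; r           = λ i → X.r (⟪ i ⟫ 0) , Y.r (⟪ i ⟫ 1)
  ; dense       = λ (x , y) ε 0<ε → dns x y ε (X.dense x ε 0<ε) (Y.dense y ε 0<ε)
  ; ≤-recursive = rel-⇔ (λ { (i ∷ j ∷ m ∷ k ∷ []) → mk⇔ (λ (f , g) → [ f , g ]) < _∘ inj₁ , _∘ inj₂ > })
      (rel-∧ (rel-subst X.≤-recursive (at 0)) (rel-subst Y.≤-recursive (at 1)))
  ; <-recursive = rel-⇔ (λ { (i ∷ j ∷ m ∷ k ∷ []) → mk⇔ id id })
      (rel-∧ (rel-subst X.<-recursive (at 0)) (rel-subst Y.<-recursive (at 1)))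
  }
  where
  module X = RecPolish X
  module Y = RecPolish Y
  dns : ∀ x y ε → (∃ λ i → X.d x (X.r i) <ᵣ ε) → (∃ λ j → Y.d y (Y.r j) <ᵣ ε) →
        ∃ λ i → X.d x (X.r (⟪ i ⟫ 0)) <ᵣ ε × Y.d y (Y.r (⟪ i ⟫ 1)) <ᵣ ε
  dns x y ε (i , u) (j , v) = code α 2 ,
    subst (λ i → X.d x (X.r i) <ᵣ ε) (sym (⟪code⟫ α 2 0 (s≤s z≤n))) u ,
    subst (λ j → Y.d y (Y.r j) <ᵣ ε) (sym (⟪code⟫ α 2 1 (s≤s (s≤s z≤n)))) v
    where
    α : ℕ → ℕ
    α zero    = i
    α (suc _) = j
  sub : ℕ → Fin 4 → Vec ℕ 4 → ℕ
  sub c zero       v = ⟪ lookup v zero ⟫ c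
  sub c (suc zero) v = ⟪ lookup v (suc zero) ⟫ c
  sub c (suc (suc l)) v = lookup v (suc (suc l))
  at : ∀ c l → Recursive (sub c l)
  at c zero          = ap₂ ⟪_⟫ rec-⟪⟫ (proj zero) (constant c)
  at c (suc zero)    = ap₂ ⟪_⟫ rec-⟪⟫ (proj (suc zero)) (constant c)
  at c (suc (suc l)) = proj (suc (suc l))

data Type≤1 : RecPolish → Set₁ where
  is-ω   : Type≤1 ω
  is-ω^ω : Type≤1 ω^ω
  is-2^ω : Type≤1 2^ω
  is-⊗   : ∀ {X Y} → Type≤1 X → Type≤1 Y → Type≤1 (X ⊗ Y)

-- The ball about r_(k)₀ of radius (k)₁/((k)₂+1).
N : (X : RecPolish) → ℕ → Pred ∣ X ∣ 0ℓ
N X k x = d x (r (⟪ k ⟫ 0)) <ᵣ frac (⟪ k ⟫ 1) (⟪ k ⟫ 2)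
  where open RecPolish X

-- The open set enumerated by ε; N X 0 is empty, so ε may enumerate nothing.
⋃N : (X : RecPolish) → (ℕ → ℕ) → Pred ∣ X ∣ 0ℓ
⋃N X ε x = ∃ λ i → x ∈ N X (ε i)

Open : (X : RecPolish) → Pred ∣ X ∣ 0ℓ → Set
Open X P = ∃ λ ε → P ≐ ⋃N X ε

Σ⁰₁ : (X : RecPolish) → Pred ∣ X ∣ 0ℓ → Set
Σ⁰₁ X P = ∃ λ ε → Recursive₁ ε × P ≐ ⋃N X ε

RecursiveMap : (X Y : RecPolish) → (∣ X ∣ → ∣ Y ∣) → Set
RecursiveMap X Y f = Σ⁰₁ (X ⊗ ω) λ (x , k) → f x ∈ N Y k

section : {A B : Set} → Pred (A × B) 0ℓ → A → Pred B 0ℓ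
section E x y = (x , y) ∈ E

record GoodParametrization : Set₁ where
  field
    G      : (X : RecPolish) → Pred (∣ ω^ω ∣ × ∣ X ∣) 0ℓ
    G-Σ⁰₁  : ∀ X → Σ⁰₁ (ω^ω ⊗ X) (G X)
    open⇔  : ∀ X P → Open X P ⇔ ∃ λ γ → P ≐ section (G X) γ
    Σ⁰₁⇔   : ∀ X P → Σ⁰₁ X P ⇔ ∃ λ γ → Recursive₁ γ × P ≐ section (G X) γ
    S      : ∀ X Y → Type≤1 X → ∃ λ (S : ∣ ω^ω ⊗ X ∣ → ∣ ω^ω ∣) →
             RecursiveMap (ω^ω ⊗ X) ω^ω S ×
             ∀ γ x y → (γ , x , y) ∈ G (X ⊗ Y) ⇔ (S (γ , x) , y) ∈ G Y

-- Trees denote countable ordinals, lim f being the supremum of the values of f;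
-- every countable ordinal is denoted by some tree.  Different trees may denote
-- the same ordinal, and _≼_ and _≺_ compare the ordinals denoted.
data Ord : Set where
  zero : Ord
  suc  : Ord → Ord
  lim  : (ℕ → Ord) → Ord

infix 4 _≼_ _≺_

_≼_ _≺_ : Ord → Ord → Set
zero  ≼ β = ⊤
suc α ≼ β = α ≺ β
lim f ≼ β = ∀ n → f n ≼ β
α ≺ zero  = ⊥
α ≺ suc β = α ≼ β
α ≺ lim f = ∃ λ n → α ≺ f n

𝟙 𝟚 : Ord
𝟙 = suc zero
𝟚 = suc 𝟙

_⋆ : (ℕ → ℕ) → ℕ → ℕ
(γ ⋆) i = γ (suc i)

module Codes (𝔾 : GoodParametrization) where
  open GoodParametrization 𝔾

  -- y is the value {γ}(x); it is unique, since the sets N Y k separate points.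
  IsValue : (X Y : RecPolish) → ∣ ω^ω ∣ → ∣ X ∣ → ∣ Y ∣ → Set
  IsValue X Y γ x y = ∀ k → y ∈ N Y k ⇔ (γ , x , k) ∈ G (X ⊗ ω)

  -- An inductive definition is the recursion on ξ, since _≺_ is well-founded.
  data BC : Ord → Pred ∣ ω^ω ∣ 0ℓ where
    bc₁ : ∀ {ξ γ} → ξ ≼ 𝟙 → 𝟙 ≼ ξ → γ 0 ≡ 0 → BC ξ γ
    bc₂ : ∀ {ξ γ} → 𝟚 ≼ ξ → γ 0 ≡ 1 →
          (∀ i → ∃ λ β → IsValue ω ω^ω (γ ⋆) i β × ∃ λ η → 𝟙 ≼ η × η ≺ ξ × BC η β) →
          BC ξ γ

  BC∞ : Pred ∣ ω^ω ∣ 0ℓ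
  BC∞ γ = ∃ λ ξ → 𝟙 ≼ ξ × BC ξ γ

  mutual

    ρ-BC : (X : RecPolish) {ξ : Ord} {γ : ∣ ω^ω ∣} → γ ∈ BC ξ → Pred ∣ X ∣ 0ℓ
    ρ-BC X {γ = γ} (bc₁ _ _ _) = ⋃N X (γ ⋆)
    ρ-BC X {ξ} {γ} (bc₂ _ _ β) = λ x → ∃ λ i → ¬ ρ-value X {ξ} {γ ⋆} {i} (β i) x

    ρ-value : (X : RecPolish) {ξ : Ord} {δ : ∣ ω^ω ∣} {i : ℕ} →
              (∃ λ β → IsValue ω ω^ω δ i β × ∃ λ η → 𝟙 ≼ η × η ≺ ξ × BC η β) →
              Pred ∣ X ∣ 0ℓ
    ρ-value X (_ , _ , _ , _ , _ , β∈BC) = ρ-BC X β∈BC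

  ρ : (X : RecPolish) (γ : ∣ ω^ω ∣) → γ ∈ BC∞ → Pred ∣ X ∣ 0ℓ
  ρ X _ (_ , _ , γ∈BC) = ρ-BC X γ∈BC

{-# OPTIONS --safe #-}
module Submission where

-- Identify the points of a space of type at most 1 with sequences of naturals; Σ⁰₁ sets
-- then become the sets given by finite certificates.  For a code γ of an open set, the
-- balls N(X × Y, k) containing (x , y) are products of balls, and membership of x in the
-- first factor is decidable because X is zero-dimensional; so the section at x is
-- enumerated by the second factors of those balls whose first factor contains x, which
-- does not depend on Y.  For other codes the section has to satisfy
-- {u(γ,x)*}(i) = u({γ*}(i),x), which is a self-reference solved by Kleene's recursion
-- theorem; {γ*}(i) is only a partial function, but a Σ⁰₁ condition on its value is Σ⁰₁,
-- since G enumerates the balls containing that value.  Correctness is an induction on codes.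

open import Data.Bool.Base using (Bool; true; false)
open import Data.Fin.Base using (suc)
open import Data.Fin.Patterns
open import Data.Nat.Base
open import Data.Nat.GeneralisedArithmetic using (fold)
open import Data.Nat.Properties
open import Data.Product.Base using (∃; _×_; _,_; proj₁; proj₂; map₂; <_,_>)
open import Data.Rational.Unnormalised.Base as ℚ using (0ℚᵘ)
import Data.Rational.Unnormalised.Properties as ℚ
open import Data.Sum.Base using (_⊎_; inj₁; inj₂; [_,_])
open import Data.Vec.Base using (Vec; []; _∷_; lookup)
open import Defs
open import Function.Base using (id; _∘_; const)
open import Function.Bundles using (_⇔_; mk⇔; Equivalence)
open import Function.Properties.Equivalence using () renaming (trans to infixr 2 _⇔∘_)
open import Level using (0ℓ)
open import Relation.Binary.PropositionalEquality hiding ([_])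
open import Relation.Nullary using (¬_; Dec; yes; no; contradiction)
import Relation.Nullary.Decidable as Dec
open import Relation.Unary using (Pred; Decidable; _∈_; _≐_)

open Equivalence using (to; from)

-- Bounds on the components of coded pairs and lists, and recursive relations.

π₂≤ : ∀ n → π₂ n ≤ n
π₂≤ n = ≤-trans (π₂-≤ n) pred[n]≤n

π₁≤ : ∀ n → π₁ n ≤ n
π₁≤ n = ≤-trans (m∸n≤m (isqrt n) (π₂ n)) (≤-trans (m≤m*m (isqrt n)) (proj₁ (isqrt-spec n)))
  where
  m≤m*m : ∀ m → m ≤ m * m
  m≤m*m zero    = z≤n
  m≤m*m (suc m) = m≤m*n (suc m) (suc m)

⟪⟫≤ : ∀ k n → ⟪ k ⟫ n ≤ k
⟪⟫≤ k n = ≤-trans (π₁≤ (fold k π₂ n)) (tail≤ n)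
  where
  tail≤ : ∀ n → fold k π₂ n ≤ k
  tail≤ zero    = ≤-refl
  tail≤ (suc n) = ≤-trans (π₂≤ (fold k π₂ n)) (tail≤ n)

rec-pair : Recursive₂ pair
rec-pair = ap₂ _+_ rec-+ (ap₂ _*_ rec-* rec-+ rec-+) (proj 1F)

pair-injective : ∀ {a b c d} → pair a b ≡ pair c d → a ≡ c × b ≡ d
pair-injective {a} {b} {c} {d} e =
  trans (sym (π₁-pair a b)) (trans (cong π₁ e) (π₁-pair c d)) ,
  trans (sym (π₂-pair a b)) (trans (cong π₂ e) (π₂-pair c d))

Rel₂ : (ℕ → ℕ → Set) → Set
Rel₂ R = RecursiveRel {2} λ v → R (lookup v 0F) (lookup v 1F)

Rel₃ : (ℕ → ℕ → ℕ → Set) → Set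
Rel₃ R = RecursiveRel {3} λ v → R (lookup v 0F) (lookup v 1F) (lookup v 2F)

module _ {n : ℕ} where

  private
    variable
      a b c : Vec ℕ n → ℕ

  ap₃ : (f : ℕ → ℕ → ℕ → ℕ) → Recursive {3} (λ v → f (lookup v 0F) (lookup v 1F) (lookup v 2F)) →
        Recursive a → Recursive b → Recursive c → Recursive (λ v → f (a v) (b v) (c v))
  ap₃ {a} {b} {c} f F A B C =
    comp {g = λ { 0F → a ; 1F → b ; (suc (suc _)) → c }} F (λ { 0F → A ; 1F → B ; (suc (suc _)) → C })

  rel₃ : {R : ℕ → ℕ → ℕ → Set} → Rel₃ R → Recursive a → Recursive b → Recursive c →
         RecursiveRel (λ v → R (a v) (b v) (c v))
  rel₃ {a} {b} {c} {R} r A B C =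
    rel-subst {R = λ v → R (lookup v 0F) (lookup v 1F) (lookup v 2F)}
      {g = λ { 0F → a ; 1F → b ; (suc (suc _)) → c }} r (λ { 0F → A ; 1F → B ; (suc (suc _)) → C })

  rel-∀≤ : {R : Pred (Vec ℕ (suc n)) 0ℓ} → Recursive b → RecursiveRel R →
           RecursiveRel (λ v → ∀ m → m ≤ b v → R (m ∷ v))
  rel-∀≤ B r = rel-⇔ (λ v → mk⇔ (λ h m m≤ → h m (s≤s m≤)) (λ h m m< → h m (s≤s⁻¹ m<)))
    (rel-∀< (ap₁ suc rec-suc B) r)

-- Balls and their indices.

-- The ball of radius m/(l+1) about the c-th dense point has this index.
ball : ℕ → ℕ → ℕ → ℕ
ball c m l = pair c (pair m (pair l 0))

⟪ball⟫₀ : ∀ c m l → ⟪ ball c m l ⟫ 0 ≡ c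
⟪ball⟫₀ c m l = π₁-pair c _

⟪ball⟫₁ : ∀ c m l → ⟪ ball c m l ⟫ 1 ≡ m
⟪ball⟫₁ c m l = trans (cong π₁ (π₂-pair c _)) (π₁-pair m _)

⟪ball⟫₂ : ∀ c m l → ⟪ ball c m l ⟫ 2 ≡ l
⟪ball⟫₂ c m l = trans (cong (π₁ ∘ π₂) (π₂-pair c _)) (trans (cong π₁ (π₂-pair m _)) (π₁-pair l 0))

module _ {n : ℕ} where

  rec-ball : {a b c : Vec ℕ n → ℕ} → Recursive a → Recursive b → Recursive c →
             Recursive (λ v → ball (a v) (b v) (c v))
  rec-ball A B C = ap₂ pair rec-pair A (ap₂ pair rec-pair B (ap₂ pair rec-pair C (constant 0)))

  rec-at : {a : Vec ℕ n → ℕ} (c : ℕ) → Recursive a → Recursive (λ v → ⟪ a v ⟫ c)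
  rec-at c A = ap₂ ⟪_⟫ rec-⟪⟫ A (constant c)

module _ (X : RecPolish) where
  open RecPolish X

  N-ball : ∀ x c m l → x ∈ N X (ball c m l) ⇔ d x (r c) <ᵣ frac m l
  N-ball x c m l = mk⇔ (subst id eq) (subst id (sym eq))
    where
    eq : (x ∈ N X (ball c m l)) ≡ (d x (r c) <ᵣ frac m l)
    eq = trans (cong (λ c′ → d x (r c′) <ᵣ frac (⟪ ball c m l ⟫ 1) (⟪ ball c m l ⟫ 2)) (⟪ball⟫₀ c m l))
               (cong₂ (λ m′ l′ → d x (r c) <ᵣ frac m′ l′) (⟪ball⟫₁ c m l) (⟪ball⟫₂ c m l))

  -- Index 0 codes a ball of radius 0. It is the filler wherever an enumeration has to contribute
  -- nothing.
  N0-empty : ∀ x → ¬ x ∈ N X 0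
  N0-empty x x∈ = ℚ.<-irrefl ℚ.≃-refl (nonneg x (r 0) _ x∈)

-- Opaque, because the unfolding is far too large for conversion checking.
opaque

  left right : ℕ → ℕ
  left  k = ball (⟪ ⟪ k ⟫ 0 ⟫ 0) (⟪ k ⟫ 1) (⟪ k ⟫ 2)
  right k = ball (⟪ ⟪ k ⟫ 0 ⟫ 1) (⟪ k ⟫ 1) (⟪ k ⟫ 2)

  rec-left : Recursive₁ left
  rec-left = rec-ball (rec-at 0 (rec-at 0 (proj 0F))) (rec-at 1 (proj 0F)) (rec-at 2 (proj 0F))

  rec-right : Recursive₁ right
  rec-right = rec-ball (rec-at 1 (rec-at 0 (proj 0F))) (rec-at 1 (proj 0F)) (rec-at 2 (proj 0F))

  N-⊗ : ∀ X Y k x y → (x , y) ∈ N (X ⊗ Y) k ⇔ (x ∈ N X (left k) × y ∈ N Y (right k))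
  N-⊗ X Y k x y =
    let at = λ Z z c → N-ball Z z (⟪ ⟪ k ⟫ 0 ⟫ c) (⟪ k ⟫ 1) (⟪ k ⟫ 2) in
    mk⇔ (λ (p , q) → from (at X x 0) p , from (at Y y 1) q)
        (λ (p , q) → to (at X x 0) p , to (at Y y 1) q)

-- Points of spaces of type at most 1 as sequences of naturals.

-- Type≤1 is indexed by records, which are expensive to unify; shapes are names for them.
infixr 2 _⊠_

data Shape : Set where
  nat baire cantor : Shape
  _⊠_              : Shape → Shape → Shape

⟦_⟧ : Shape → RecPolish
⟦ nat    ⟧ = ω
⟦ baire  ⟧ = ω^ω
⟦ cantor ⟧ = 2^ω
⟦ s ⊠ t  ⟧ = ⟦ s ⟧ ⊗ ⟦ t ⟧

Pt : Shape → Set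
Pt s = ∣ ⟦ s ⟧ ∣

shape : ∀ {X} → Type≤1 X → ∃ λ s → X ≡ ⟦ s ⟧
shape is-ω   = nat , refl
shape is-ω^ω = baire , refl
shape is-2^ω = cantor , refl
shape (is-⊗ p q) with shape p | shape q
... | s , refl | t , refl = (s ⊠ t) , refl

type≤1 : ∀ s → Type≤1 ⟦ s ⟧
type≤1 nat     = is-ω
type≤1 baire   = is-ω^ω
type≤1 cantor  = is-2^ω
type≤1 (s ⊠ t) = is-⊗ {⟦ s ⟧} {⟦ t ⟧} (type≤1 s) (type≤1 t)

bit : Bool → ℕ
bit false = 0
bit true  = 1

bit-injective : ∀ {a b} → bit a ≡ bit b → a ≡ b
bit-injective {false} {false} _ = refl
bit-injective {true}  {true}  _ = refl

private
  variable
    s t u : Shape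

-- A number becomes a constant sequence, so that distinct numbers differ already at index 0, which
-- matches their distance 1.
enc : (s : Shape) → Pt s → ℕ → ℕ
enc nat       n       i = n
enc baire     α       i = α i
enc cantor    α       i = bit (α i)
enc (s ⊠ t) (x , y) i = pair (enc s x i) (enc t y i)

-- This is `Near` for the radius m/(l+1), with the comparison of fractions cross-multiplied.
Agree : (α β : ℕ → ℕ) → ℕ → ℕ → Set
Agree α β m l = 0 < m × ∀ i → m * suc i ≤ 1 * suc l → α i ≡ β i

0<frac⇔ : ∀ m l → 0ℚᵘ ℚ.< frac m l ⇔ 0 < m
0<frac⇔ m l = mk⇔ (λ lt → subst (0 <_) (*-identityʳ m) (frac-<⁻ {0} {0} {m} {l} lt))
                  (λ lt → frac-<⁺ {0} {0} (subst (0 <_) (sym (*-identityʳ m)) lt))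

-- enc is an isometric embedding into Baire space.
d<⇔Agree : (t : Shape) → ∀ x y m l →
           RecPolish.d ⟦ t ⟧ x y <ᵣ frac m l ⇔ Agree (enc t x) (enc t y) m l
d<⇔Agree nat x y m l = mk⇔ f g
  where
  f : RecPolish.d ω x y <ᵣ frac m l → Agree (const x) (const y) m l
  f lt with x ≟ y
  ... | yes e = to (0<frac⇔ m l) lt , λ _ _ → e
  -- Distinct numbers have distance 1, so here the radius exceeds 1 and no index satisfies the
  -- premise of the agreement.
  ... | no _  = <-trans (s≤s z≤n) 1+l<m , λ i m≤ → contradiction
    (≤-<-trans (≤-trans (m≤m*n m (suc i)) (≤-trans m≤ (≤-reflexive (*-identityˡ _)))) 1+l<m) (<-irrefl refl)
    where 1+l<m = subst₂ _<_ (*-identityˡ (suc l)) (*-identityʳ m) (frac-<⁻ {1} {0} lt)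
  g : Agree (const x) (const y) m l → RecPolish.d ω x y <ᵣ frac m l
  g (0<m , h) with x ≟ y
  ... | yes _ = from (0<frac⇔ m l) 0<m
  ... | no ¬e = frac-<⁺ {1} {0} (≰⇒> λ m≤ → ¬e (h 0 m≤))
d<⇔Agree baire α β m l = mk⇔
  (λ (0<q , h) → to (0<frac⇔ m l) 0<q , λ i le → h i (frac-≤⁺ {m} le))
  (λ (0<m , h) → from (0<frac⇔ m l) 0<m , λ i le → h i (frac-≤⁻ {m} le))
d<⇔Agree cantor α β m l = mk⇔
  (λ (0<q , h) → to (0<frac⇔ m l) 0<q , λ i le → cong bit (h i (frac-≤⁺ {m} le)))
  (λ (0<m , h) → from (0<frac⇔ m l) 0<m , λ i le → bit-injective (h i (frac-≤⁻ {m} le)))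
d<⇔Agree (s ⊠ t) (x , y) (x′ , y′) m l = mk⇔
  (λ (p , q) → let (0<m , h) = to (d<⇔Agree s x x′ m l) p ; (_ , h′) = to (d<⇔Agree t y y′ m l) q in
    0<m , λ i le → cong₂ pair (h i le) (h′ i le))
  (λ (0<m , h) →
    let split = λ i le → pair-injective {enc s x i} {c = enc s x′ i} (h i le) in
    from (d<⇔Agree s x x′ m l) (0<m , λ i le → proj₁ (split i le)) ,
    from (d<⇔Agree t y y′ m l) (0<m , λ i le → proj₂ (split i le)))

enc-r : (t : Shape) → ℕ → ℕ → ℕ
enc-r t c = enc t (RecPolish.r ⟦ t ⟧ c)

rec-enc-r : (t : Shape) → Recursive₂ (enc-r t)
rec-enc-r nat       = proj 0F
rec-enc-r baire     = rec-⟪⟫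
rec-enc-r cantor    = ext (λ v → sgn (lookup v 0F) (lookup v 1F))
  (ap₂ _∸_ rec-∸ (constant 1) (ap₂ _∸_ rec-∸ (constant 1) rec-⟪⟫))
  where
  sgn : ∀ c i → 1 ∸ (1 ∸ ⟪ c ⟫ i) ≡ enc-r cantor c i
  sgn c i with ⟪ c ⟫ i
  ... | zero  = refl
  ... | suc n = cong (1 ∸_) (0∸n≡0 n)
rec-enc-r (s ⊠ t) = ap₂ pair rec-pair
  (ap₂ (enc-r s) (rec-enc-r s) (rec-at 0 (proj 0F)) (proj 1F))
  (ap₂ (enc-r t) (rec-enc-r t) (rec-at 1 (proj 0F)) (proj 1F))

-- Semirecursive sets and their closure properties.

rel-¬ : ∀ {n} {R : Pred (Vec ℕ n) 0ℓ} → RecursiveRel R → RecursiveRel (λ v → ¬ R v)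
rel-¬ r = rel-⇔ (λ v → mk⇔ (λ h p → n≮0 (h p)) (λ h p → contradiction p h))
  (rel-⇒ r (rel-< (constant 0) (constant 0)))

-- Checks read their data through projections of packed numbers; this passes to the components.
pair⇔ : ∀ (Q : ℕ → ℕ → Set) a b → Q (π₁ (pair a b)) (π₂ (pair a b)) ⇔ Q a b
pair⇔ Q a b = mk⇔ (subst₂ Q (π₁-pair a b) (π₂-pair a b)) (subst₂ Q (sym (π₁-pair a b)) (sym (π₂-pair a b)))

-- The certificate w also bounds the part of the point that is inspected.
record Semirecursive (t : Shape) (P : Pred (Pt t) 0ℓ) : Set₁ where
  field
    check      : ℕ → ℕ → ℕ → Set
    rec-check  : Rel₃ check
    certified  : ∀ x → P x ⇔ ∃ λ w → ∀ i → i ≤ w → check i (enc t x i) w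

open Semirecursive

rel-check : ∀ {n} {a b c : Vec ℕ n → ℕ} {P : Pred (Pt t) 0ℓ} (p : Semirecursive t P) →
            Recursive a → Recursive b → Recursive c → RecursiveRel (λ v → p .check (a v) (b v) (c v))
rel-check p = rel₃ {R = p .check} (p .rec-check)

-- Entry i of the image depends only on i and on entry i of the argument, so semirecursive sets are
-- pulled back with the same certificates.
record Pointwise (s t : Shape) (f : Pt s → Pt t) : Set where
  field
    op     : ℕ → ℕ → ℕ
    rec-op : Recursive₂ op
    enc-op : ∀ x i → op i (enc s x i) ≡ enc t (f x) i

open Pointwise

record Computable (s t : Shape) (f : Pt s → Pt t) : Set₁ where
  constructor computable
  field
    graph : Semirecursive ((s ⊠ nat) ⊠ nat) (λ ((x , i) , j) → enc t (f x) i ≡ j)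

open Computable

pw-fst : Pointwise (s ⊠ t) s proj₁
pw-fst .op i y = π₁ y
pw-fst .rec-op = ap₁ π₁ rec-π₁ (proj 1F)
pw-fst {s = s} {t = t} .enc-op (x , y) i = π₁-pair (enc s x i) (enc t y i)

pw-snd : Pointwise (s ⊠ t) t proj₂
pw-snd .op i y = π₂ y
pw-snd .rec-op = ap₁ π₂ rec-π₂ (proj 1F)
pw-snd {s = s} {t = t} .enc-op (x , y) i = π₂-pair (enc s x i) (enc t y i)

pw-id : Pointwise s s id
pw-id .op i y = y
pw-id .rec-op = proj 1F
pw-id .enc-op x i = refl

pw-const : ∀ c → Pointwise s nat (const c)
pw-const c .op i y = c
pw-const c .rec-op = constant c
pw-const c .enc-op x i = refl

pw-constˢ : ∀ {α} → Recursive₁ α → Pointwise s baire (const α)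
pw-constˢ {α = α} A .op i y = α i
pw-constˢ {α = α} A .rec-op = ap₁ α A (proj 0F)
pw-constˢ A .enc-op x i = refl

pw-∘ : {f : Pt s → Pt t} {g : Pt t → Pt u} → Pointwise t u g → Pointwise s t f → Pointwise s u (g ∘ f)
pw-∘ G F .op i y = G .op i (F .op i y)
pw-∘ G F .rec-op = ap₂ (G .op) (G .rec-op) (proj 0F) (F .rec-op)
pw-∘ {f = f} G F .enc-op x i = trans (cong (G .op i) (F .enc-op x i)) (G .enc-op (f x) i)

pw-pair : {f : Pt s → Pt t} {g : Pt s → Pt u} →
          Pointwise s t f → Pointwise s u g → Pointwise s (t ⊠ u) < f , g >
pw-pair F G .op i y = pair (F .op i y) (G .op i y)
pw-pair F G .rec-op = ap₂ pair rec-pair (F .rec-op) (G .rec-op)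
pw-pair F G .enc-op x i = cong₂ pair (F .enc-op x i) (G .enc-op x i)

pw-num₁ : (a : ℕ → ℕ) → Recursive₁ a → Pointwise nat nat a
pw-num₁ a A .op i y = a y
pw-num₁ a A .rec-op = ap₁ a A (proj 1F)
pw-num₁ a A .enc-op x i = refl

pw-num₂ : (a : ℕ → ℕ → ℕ) → Recursive₂ a → Pointwise (nat ⊠ nat) nat (λ p → a (proj₁ p) (proj₂ p))
pw-num₂ a A .op i y = a (π₁ y) (π₂ y)
pw-num₂ a A .rec-op = ap₂ a A (ap₁ π₁ rec-π₁ (proj 1F)) (ap₁ π₂ rec-π₂ (proj 1F))
pw-num₂ a A .enc-op (m , n) i = cong₂ a (π₁-pair m n) (π₂-pair m n)

semi-⇔ : {P Q : Pred (Pt s) 0ℓ} → (∀ x → P x ⇔ Q x) → Semirecursive s P → Semirecursive s Q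
semi-⇔ e p .check = p .check
semi-⇔ e p .rec-check = p .rec-check
semi-⇔ e p .certified x = mk⇔ (to (p .certified x) ∘ from (e x)) (to (e x) ∘ from (p .certified x))

semi-pw : {P : Pred (Pt t) 0ℓ} {f : Pt s → Pt t} →
          Pointwise s t f → Semirecursive t P → Semirecursive s (P ∘ f)
semi-pw F p .check i y w = p .check i (F .op i y) w
semi-pw F p .rec-check = rel-check p (proj 0F)
  (ap₂ (F .op) (F .rec-op) (proj 0F) (proj 1F)) (proj 2F)
semi-pw {f = f} F p .certified x = mk⇔
  (λ h → map₂ (λ c i i≤ → subst (λ y → p .check i y _) (sym (F .enc-op x i)) (c i i≤))
              (to (p .certified (f x)) h))
  (λ (w , c) → from (p .certified (f x))
    (w , λ i i≤ → subst (λ y → p .check i y w) (F .enc-op x i) (c i i≤)))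

semi-≡ : Semirecursive (nat ⊠ nat) (λ p → proj₁ p ≡ proj₂ p)
semi-≡ .check i y w = π₁ y ≡ π₂ y
semi-≡ .rec-check = rel-≡ (ap₁ π₁ rec-π₁ (proj 1F)) (ap₁ π₂ rec-π₂ (proj 1F))
semi-≡ .certified (m , n) = mk⇔
  (λ e → 0 , λ i _ → from (pair⇔ _≡_ m n) e)
  (λ (w , c) → to (pair⇔ _≡_ m n) (c 0 z≤n))

-- The certificate only has to be at least i, so that entry i is among those inspected; the other
-- entries are left untested.
semi-enc : Semirecursive ((s ⊠ nat) ⊠ nat) (λ ((x , i) , j) → enc s x i ≡ j)
semi-enc .check i′ y w = π₂ (π₁ y) ≤ w × (i′ ≡ π₂ (π₁ y) → π₁ (π₁ y) ≡ π₂ y)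
semi-enc .rec-check = rel-∧ (rel-≤ i (proj 2F)) (rel-⇒ (rel-≡ (proj 0F) i)
    (rel-≡ (ap₁ π₁ rec-π₁ (ap₁ π₁ rec-π₁ (proj 1F))) (ap₁ π₂ rec-π₂ (proj 1F))))
  where
  i : Recursive {3} (λ v → π₂ (π₁ (lookup v 1F)))
  i = ap₁ π₂ rec-π₂ (ap₁ π₁ rec-π₁ (proj 1F))
semi-enc {s = s} .certified ((x , i) , j) = mk⇔
  (λ e → i , λ i′ _ → from (spec i′ i) (≤-refl , λ { refl → e }))
  (λ (w , c) → let (i≤w , _) = to (spec 0 w) (c 0 z≤n) in proj₂ (to (spec i w) (c i i≤w)) refl)
  where
  spec : ∀ i′ w → semi-enc {s = s} .check i′ (pair (pair (enc s x i′) i) j) w ⇔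
                  (i ≤ w × (i′ ≡ i → enc s x i′ ≡ j))
  spec i′ w = pair⇔ (λ y k → π₂ y ≤ w × (i′ ≡ π₂ y → π₁ y ≡ k)) (pair (enc s x i′) i) j ⇔∘
              pair⇔ (λ y k → k ≤ w × (i′ ≡ k → y ≡ j)) (enc s x i′) i

-- The two certificates are packed into one number. It bounds both components, so enough entries are
-- inspected; the guards confine each check to the entries that its own certificate allows.
semi-∧ : {P Q : Pred (Pt s) 0ℓ} → Semirecursive s P → Semirecursive s Q → Semirecursive s (λ x → P x × Q x)
semi-∧ p q .check i y w = (i ≤ π₁ w → p .check i y (π₁ w)) × (i ≤ π₂ w → q .check i y (π₂ w))
semi-∧ p q .rec-check = rel-∧
  (rel-⇒ (rel-≤ (proj 0F) fst) (rel-check p (proj 0F) (proj 1F) fst))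
  (rel-⇒ (rel-≤ (proj 0F) snd) (rel-check q (proj 0F) (proj 1F) snd))
  where
  fst : Recursive {3} (λ v → π₁ (lookup v 2F))
  fst = ap₁ π₁ rec-π₁ (proj 2F)
  snd : Recursive {3} (λ v → π₂ (lookup v 2F))
  snd = ap₁ π₂ rec-π₂ (proj 2F)
semi-∧ {s = s} p q .certified x = mk⇔
  (λ (a , b) → let (v , c) = to (p .certified x) a ; (w , d) = to (q .certified x) b in
    pair v w , λ i _ → from (pair⇔
      (λ v w → (i ≤ v → p .check i (enc s x i) v) × (i ≤ w → q .check i (enc s x i) w)) v w) (c i , d i))
  (λ (w , c) →
    from (p .certified x) (π₁ w , λ i i≤ → proj₁ (c i (≤-trans i≤ (π₁≤ w))) i≤) ,
    from (q .certified x) (π₂ w , λ i i≤ → proj₂ (c i (≤-trans i≤ (π₂≤ w))) i≤))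

semi-∨ : {P Q : Pred (Pt s) 0ℓ} → Semirecursive s P → Semirecursive s Q → Semirecursive s (λ x → P x ⊎ Q x)
-- The certificate is tagged with the disjunct that it certifies.
semi-∨ p q .check i y w = i ≤ π₂ w → (π₁ w ≡ 0 → p .check i y (π₂ w)) × (0 < π₁ w → q .check i y (π₂ w))
semi-∨ p q .rec-check = rel-⇒ (rel-≤ (proj 0F) v) (rel-∧
  (rel-⇒ (rel-≡ (ap₁ π₁ rec-π₁ (proj 2F)) (constant 0)) (rel-check p (proj 0F) (proj 1F) v))
  (rel-⇒ (rel-< (constant 0) (ap₁ π₁ rec-π₁ (proj 2F))) (rel-check q (proj 0F) (proj 1F) v)))
  where
  v : Recursive {3} (λ v → π₂ (lookup v 2F))
  v = ap₁ π₂ rec-π₂ (proj 2F)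
semi-∨ {s = s} {P = P} {Q = Q} p q .certified x = mk⇔ f g
  where
  spec : ∀ i b w → semi-∨ {s = s} p q .check i (enc s x i) (pair b w) ⇔
                   (i ≤ w → (b ≡ 0 → p .check i (enc s x i) w) × (0 < b → q .check i (enc s x i) w))
  spec i = pair⇔ (λ b w → i ≤ w → (b ≡ 0 → p .check i (enc s x i) w) × (0 < b → q .check i (enc s x i) w))
  f : P x ⊎ Q x → _
  f (inj₁ a) = let (w , c) = to (p .certified x) a in
    pair 0 w , λ i _ → from (spec i 0 w) λ i≤ → (λ _ → c i i≤) , λ ()
  f (inj₂ b) = let (w , c) = to (q .certified x) b in
    pair 1 w , λ i _ → from (spec i 1 w) λ i≤ → (λ ()) , λ _ → c i i≤
  g : _ → P x ⊎ Q x
  g (w , c) with π₁ w ≟ 0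
  ... | yes e = inj₁ (from (p .certified x) (π₂ w , λ i i≤ → proj₁ (c i (≤-trans i≤ (π₂≤ w)) i≤) e))
  ... | no ¬e = inj₂ (from (q .certified x) (π₂ w , λ i i≤ → proj₂ (c i (≤-trans i≤ (π₂≤ w)) i≤) (n≢0⇒n>0 ¬e)))

semi-∃ : {P : Pred (Pt s × ℕ) 0ℓ} → Semirecursive (s ⊠ nat) P → Semirecursive s (λ x → ∃ λ n → P (x , n))
semi-∃ p .check i y w = i ≤ π₂ w → p .check i (pair y (π₁ w)) (π₂ w)
semi-∃ p .rec-check = rel-⇒ (rel-≤ (proj 0F) (ap₁ π₂ rec-π₂ (proj 2F)))
  (rel-check p (proj 0F) (ap₂ pair rec-pair (proj 1F) (ap₁ π₁ rec-π₁ (proj 2F))) (ap₁ π₂ rec-π₂ (proj 2F)))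
semi-∃ {s = s} p .certified x = mk⇔
  (λ (n , a) → let (w , c) = to (p .certified (x , n)) a in
    pair n w , λ i _ → from (pair⇔ (λ n w → i ≤ w → p .check i (pair (enc s x i) n) w) n w) (c i))
  (λ (w , c) → π₁ w , from (p .certified (x , π₁ w)) (π₂ w , λ i i≤ → c i (≤-trans i≤ (π₂≤ w)) i≤))

-- A certificate consists of a certificate a for `p` at `f x`, a list of guessed entries of `f x` up
-- to a, and a list of certificates for these guesses. At every inspected entry of x all guesses are
-- checked, together with `p` on the guessed entries.
semi-comp : {P : Pred (Pt t) 0ℓ} {f : Pt s → Pt t} →
            Computable s t f → Semirecursive t P → Semirecursive s (P ∘ f)
semi-comp F p .check l y c = ∀ i → i ≤ π₁ c →
  p .check i (⟪ π₁ (π₂ c) ⟫ i) (π₁ c) ×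
  (l ≤ ⟪ π₂ (π₂ c) ⟫ i → F .graph .check l (pair (pair y i) (⟪ π₁ (π₂ c) ⟫ i)) (⟪ π₂ (π₂ c) ⟫ i))
semi-comp F p .rec-check = rel-∀≤ (ap₁ π₁ rec-π₁ (proj 2F)) (rel-∧
    (rel-check p (proj 0F) value (ap₁ π₁ rec-π₁ (proj 3F)))
    (rel-⇒ (rel-≤ (proj 1F) cert)
      (rel-check (F .graph) (proj 1F)
        (ap₂ pair rec-pair (ap₂ pair rec-pair (proj 2F) (proj 0F)) value) cert)))
  where
  value : Recursive {4} (λ v → ⟪ π₁ (π₂ (lookup v 3F)) ⟫ (lookup v 0F))
  value = ap₂ ⟪_⟫ rec-⟪⟫ (ap₁ π₁ rec-π₁ (ap₁ π₂ rec-π₂ (proj 3F))) (proj 0F)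
  cert : Recursive {4} (λ v → ⟪ π₂ (π₂ (lookup v 3F)) ⟫ (lookup v 0F))
  cert = ap₂ ⟪_⟫ rec-⟪⟫ (ap₁ π₂ rec-π₂ (ap₁ π₂ rec-π₂ (proj 3F))) (proj 0F)
semi-comp {t = t} {s = s} {P = P} {f = f} F p .certified x = mk⇔ forth back
  where
  Q : ℕ → ℕ → ℕ → ℕ → Set
  Q l a v b = ∀ i → i ≤ a → p .check i (⟪ v ⟫ i) a ×
    (l ≤ ⟪ b ⟫ i → F .graph .check l (pair (pair (enc s x l) i) (⟪ v ⟫ i)) (⟪ b ⟫ i))
  forth : P (f x) → _
  forth h = pair a (pair v b) , λ l _ →
    from (pair⇔ (λ a d → Q l a (π₁ d) (π₂ d)) a (pair v b)) (from (pair⇔ (Q l a) v b) (λ i i≤ →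
      subst (λ j → p .check i j a) (sym (⟪code⟫ y (suc a) i (s≤s i≤))) (proj₂ (to (p .certified (f x)) h) i i≤) ,
      subst₂ (λ j w → l ≤ w → F .graph .check l (pair (pair (enc s x l) i) j) w)
        (sym (⟪code⟫ y (suc a) i (s≤s i≤))) (sym (⟪code⟫ (proj₁ ∘ value) (suc a) i (s≤s i≤)))
        (proj₂ (value i) l)))
    where
    y = enc t (f x)
    a = proj₁ (to (p .certified (f x)) h)
    value : ∀ i → ∃ λ w → ∀ l → l ≤ w → F .graph .check l (pair (pair (enc s x l) i) (y i)) w
    value i = to (F .graph .certified ((x , i) , y i)) refl
    v = code y (suc a)
    b = code (proj₁ ∘ value) (suc a)
  back : _ → P (f x)
  -- The test of `p` does not involve the inspected entry of x, so its instance at index 0 suffices.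
  back (c , h) = from (p .certified (f x)) (π₁ c , λ i i≤ →
    subst (λ j → p .check i j (π₁ c)) (sym (value i i≤)) (proj₁ (h 0 z≤n i i≤)))
    where
    value : ∀ i → i ≤ π₁ c → enc t (f x) i ≡ ⟪ π₁ (π₂ c) ⟫ i
    -- A listed certificate is a component of `c`, hence at most `c`, so all entries that it needs
    -- are inspected.
    value i i≤ = from (F .graph .certified ((x , i) , ⟪ π₁ (π₂ c) ⟫ i)) (⟪ π₂ (π₂ c) ⟫ i , λ l l≤ →
      proj₂ (h l (≤-trans l≤ (≤-trans (⟪⟫≤ _ i) (≤-trans (π₂≤ _) (π₂≤ c)))) i i≤) l≤)

-- Semirecursive sets are the effectively open sets.

N⇔Agree : (t : Shape) → ∀ x k →
          x ∈ N ⟦ t ⟧ k ⇔ Agree (enc t x) (enc-r t (⟪ k ⟫ 0)) (⟪ k ⟫ 1) (⟪ k ⟫ 2)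
N⇔Agree t x k = d<⇔Agree t x (RecPolish.r ⟦ t ⟧ (⟪ k ⟫ 0)) (⟪ k ⟫ 1) (⟪ k ⟫ 2)

-- A positive radius m/(l+1) is at least 1/(l+1), so a ball constrains no entry beyond l. This makes
-- membership in it decidable and bounds its certificates.
radius-bound : ∀ {m l i} → 0 < m → m * suc i ≤ 1 * suc l → i ≤ l
radius-bound {m@(suc _)} {l} {i} 0<m le = s≤s⁻¹ (begin
  suc i        ≤⟨ m≤n*m (suc i) m ⟩
  m * suc i    ≤⟨ le ⟩
  1 * suc l    ≡⟨ *-identityˡ (suc l) ⟩
  suc l        ∎)
  where open ≤-Reasoning

Agree? : ∀ α β m l → Dec (Agree α β m l)
Agree? α β m l with 0 <? m
... | no ¬0<m = no (¬0<m ∘ proj₁)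
... | yes 0<m = Dec.map′
    (λ h → 0<m , λ i le → h {i} (s≤s (radius-bound {m} 0<m le)) le)
    (λ (_ , h) {i} _ → h i)
    (allUpTo? (λ i → (m * suc i ≤? 1 * suc l) Dec.→-dec (α i ≟ β i)) (suc l))

N? : (t : Shape) → ∀ k → Decidable (N ⟦ t ⟧ k)
N? t k x = Dec.map′ (from (N⇔Agree t x k)) (to (N⇔Agree t x k)) (Agree? _ _ _ _)

Σ⁰₁-⋃ball : ∀ X {C : ℕ → ℕ → Set} → Rel₂ C → Σ⁰₁ X (λ x → ∃ λ c → ∃ λ w → C c w × x ∈ N X (ball c 1 w))
Σ⁰₁-⋃ball X {C} (χ , rec-χ , char) = ε , rec-ε , forth , back
  where
  b : ℕ → ℕ
  b n = ball (π₁ n) 1 (π₂ n)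
  χ′ : ℕ → ℕ
  χ′ n = χ (π₁ n ∷ π₂ n ∷ [])
  -- Multiplication by the characteristic function sends rejected indices to 0, the index of the
  -- empty ball.
  ε : ℕ → ℕ
  ε n = χ′ n * b n
  rec-ε : Recursive₁ ε
  rec-ε = ap₂ _*_ rec-*
    (comp {g = λ { 0F v → π₁ (lookup v 0F) ; (suc _) v → π₂ (lookup v 0F) }} rec-χ
      (λ { 0F → rec-π₁ ; (suc _) → rec-π₂ }))
    (rec-ball rec-π₁ (constant 1) rec-π₂)
  Case : ℕ → Set
  Case n = (C (π₁ n) (π₂ n) × χ′ n ≡ 1) ⊎ (¬ C (π₁ n) (π₂ n) × χ′ n ≡ 0)
  forth : ∀ {x} → (∃ λ c → ∃ λ w → C c w × x ∈ N X (ball c 1 w)) → x ∈ ⋃N X ε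
  forth {x} (c , w , h , x∈) = pair c w , by (char (π₁ (pair c w) ∷ π₂ (pair c w) ∷ []))
    where
    by : Case (pair c w) → x ∈ N X (ε (pair c w))
    by (inj₁ (_ , e)) = subst (λ k → x ∈ N X k)
      (sym (trans (cong (_* b (pair c w)) e) (*-identityˡ (b (pair c w)))))
      (from (pair⇔ (λ c w → x ∈ N X (ball c 1 w)) c w) x∈)
    by (inj₂ (¬h , _)) = contradiction (from (pair⇔ C c w) h) ¬h
  back : ∀ {x} → x ∈ ⋃N X ε → ∃ λ c → ∃ λ w → C c w × x ∈ N X (ball c 1 w)
  back {x} (n , x∈) = by (char (π₁ n ∷ π₂ n ∷ []))
    where
    by : Case n → ∃ λ c → ∃ λ w → C c w × x ∈ N X (ball c 1 w)
    by (inj₁ (h , e)) = π₁ n , π₂ n , h ,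
      subst (λ k → x ∈ N X k) (trans (cong (_* b n) e) (*-identityˡ (b n))) x∈
    by (inj₂ (_ , e)) = contradiction (subst (λ k → x ∈ N X k) (cong (_* b n) e) x∈) (N0-empty X x)

module _ (t : Shape) where

  private
    within : ℕ → ℕ → Set
    within i k = ⟪ k ⟫ 1 * suc i ≤ 1 * suc (⟪ k ⟫ 2)

    rec-k : Recursive {3} (λ v → π₂ (lookup v 1F))
    rec-k = ap₁ π₂ rec-π₂ (proj 1F)

    rec-centre : RecursiveRel {3} (λ v → π₁ (lookup v 1F) ≡ enc-r t (⟪ π₂ (lookup v 1F) ⟫ 0) (lookup v 0F))
    rec-centre = rel-≡ (ap₁ π₁ rec-π₁ (proj 1F)) (ap₂ (enc-r t) (rec-enc-r t) (rec-at 0 rec-k) (proj 0F))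

    rec-within : RecursiveRel {3} (λ v → within (lookup v 0F) (π₂ (lookup v 1F)))
    rec-within = rel-≤ (ap₂ _*_ rec-* (rec-at 1 rec-k) (ap₁ suc rec-suc (proj 0F)))
                       (ap₂ _*_ rec-* (constant 1) (ap₁ suc rec-suc (rec-at 2 rec-k)))

    rec-0<m : RecursiveRel {3} (λ v → 0 < ⟪ π₂ (lookup v 1F) ⟫ 1)
    rec-0<m = rel-< (constant 0) (rec-at 1 rec-k)

  semi-N : Semirecursive (t ⊠ nat) (λ p → proj₁ p ∈ N ⟦ t ⟧ (proj₂ p))
  semi-N .check i y w = ⟪ π₂ y ⟫ 2 ≤ w × 0 < ⟪ π₂ y ⟫ 1 ×
                        (within i (π₂ y) → π₁ y ≡ enc-r t (⟪ π₂ y ⟫ 0) i)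
  semi-N .rec-check = rel-∧ (rel-≤ (rec-at 2 rec-k) (proj 2F))
                            (rel-∧ rec-0<m (rel-⇒ rec-within rec-centre))
  semi-N .certified (x , k) = mk⇔
    (λ x∈ → let (0<m , h) = to (N⇔Agree t x k) x∈ in
      ⟪ k ⟫ 2 , λ i _ → from (spec i (⟪ k ⟫ 2)) (≤-refl , 0<m , h i))
    (λ (w , c) → let (l≤w , 0<m , _) = to (spec 0 w) (c 0 z≤n) in
      from (N⇔Agree t x k) (0<m , λ i le →
        proj₂ (proj₂ (to (spec i w) (c i (≤-trans (radius-bound {⟪ k ⟫ 1} 0<m le) l≤w)))) le))
    where
    spec : ∀ i w → semi-N .check i (pair (enc t x i) k) w ⇔
      (⟪ k ⟫ 2 ≤ w × 0 < ⟪ k ⟫ 1 × (within i k → enc t x i ≡ enc-r t (⟪ k ⟫ 0) i))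
    spec i w = pair⇔ (λ y k → ⟪ k ⟫ 2 ≤ w × 0 < ⟪ k ⟫ 1 × (within i k → y ≡ enc-r t (⟪ k ⟫ 0) i))
      (enc t x i) k

  -- The certificate is an index at which the point violates the condition of the ball, and only the
  -- entry there is tested. For radius 0 the ball is empty and every certificate passes.
  semi-∉N : Semirecursive (t ⊠ nat) (λ p → ¬ proj₁ p ∈ N ⟦ t ⟧ (proj₂ p))
  semi-∉N .check i y w = 0 < ⟪ π₂ y ⟫ 1 → i ≡ w → within i (π₂ y) × ¬ π₁ y ≡ enc-r t (⟪ π₂ y ⟫ 0) i
  semi-∉N .rec-check = rel-⇒ rec-0<m (rel-⇒ (rel-≡ (proj 0F) (proj 2F)) (rel-∧ rec-within (rel-¬ rec-centre)))
  semi-∉N .certified (x , k) = mk⇔ forth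
    (λ (w , c) x∈ → let (0<m , h) = to (N⇔Agree t x k) x∈
                        (le , ¬e) = to (spec w w) (c w ≤-refl) 0<m refl
                    in ¬e (h w le))
    where
    Clash : ℕ → Set
    Clash i = within i k × ¬ enc t x i ≡ enc-r t (⟪ k ⟫ 0) i
    spec : ∀ i w → semi-∉N .check i (pair (enc t x i) k) w ⇔ (0 < ⟪ k ⟫ 1 → i ≡ w → Clash i)
    spec i w = pair⇔ (λ y k → 0 < ⟪ k ⟫ 1 → i ≡ w → within i k × ¬ y ≡ enc-r t (⟪ k ⟫ 0) i) (enc t x i) k
    clash? : Decidable Clash
    clash? i = (_ ≤? _) Dec.×-dec Dec.¬? (_ ≟ _)
    forth : ¬ x ∈ N ⟦ t ⟧ k → ∃ λ w → ∀ i → i ≤ w → semi-∉N .check i (pair (enc t x i) k) w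
    forth x∉ with anyUpTo? clash? (suc (⟪ k ⟫ 2))
    ... | yes (w , _ , c) = w , λ i _ → from (spec i w) λ { _ refl → c }
    ... | no ¬c = 0 , λ i _ → from (spec i 0) λ 0<m _ → contradiction
      (from (N⇔Agree t x k) (0<m , λ i le → Dec.decidable-stable (_ ≟ _) λ ¬e →
        ¬c (i , s≤s (radius-bound {⟪ k ⟫ 1} 0<m le) , le , ¬e))) x∉

  opaque

    -- A certificate w accepts or rejects on the entries up to w, so it treats all points of a ball
    -- of radius 1/(w+1) alike. The set is thus the union of such balls about the dense points that
    -- pass the check.
    Σ⁰₁-semi : ∀ {P} → Semirecursive t P → Σ⁰₁ ⟦ t ⟧ P
    Σ⁰₁-semi {P} p =
      let (ε , rec-ε , ⊆ , ⊇) = Σ⁰₁-⋃ball ⟦ t ⟧ checked in ε , rec-ε , ⊆ ∘ forth , back ∘ ⊇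
      where
      open RecPolish ⟦ t ⟧ using (r; dense)
      Check : ℕ → ℕ → Set
      Check c w = ∀ i → i ≤ w → p .check i (enc-r t c i) w
      checked : Rel₂ Check
      checked = rel-∀≤ (proj 1F) (rel-check p (proj 0F)
        (ap₂ (enc-r t) (rec-enc-r t) (proj 1F) (proj 0F)) (proj 2F))
      near⇔ : ∀ x c w → x ∈ N ⟦ t ⟧ (ball c 1 w) ⇔ (∀ i → i ≤ w → enc t x i ≡ enc-r t c i)
      near⇔ x c w = N-ball ⟦ t ⟧ x c 1 w ⇔∘ d<⇔Agree t x (r c) 1 w ⇔∘ mk⇔
        (λ (_ , h) i i≤ → h i (*-monoʳ-≤ 1 (s≤s i≤)))
        (λ h → s≤s z≤n , λ i le → h i (radius-bound {1} (s≤s z≤n) le))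
      forth : ∀ {x} → P x → ∃ λ c → ∃ λ w → Check c w × x ∈ N ⟦ t ⟧ (ball c 1 w)
      forth {x} a =
        let (w , h) = to (p .certified x) a
            (c , near) = dense x (frac 1 w) (frac-pos 0 w)
            x∈ = from (N-ball ⟦ t ⟧ x c 1 w) near
        in c , w , (λ i i≤ → subst (λ y → p .check i y w) (to (near⇔ x c w) x∈ i i≤) (h i i≤)) , x∈
      back : ∀ {x} → (∃ λ c → ∃ λ w → Check c w × x ∈ N ⟦ t ⟧ (ball c 1 w)) → P x
      back {x} (c , w , h , x∈) = from (p .certified x) (w , λ i i≤ →
        subst (λ y → p .check i y w) (sym (to (near⇔ x c w) x∈ i i≤)) (h i i≤))

  semi-Σ⁰₁ : ∀ {P} → Σ⁰₁ ⟦ t ⟧ P → Semirecursive t P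
  semi-Σ⁰₁ (ε , rec-ε , P⊆ , ⊆P) = semi-⇔ (λ x → mk⇔ ⊆P P⊆)
    (semi-∃ (semi-pw (pw-pair pw-fst (pw-∘ (pw-num₁ ε rec-ε) pw-snd)) semi-N))

-- Computable maps.

comp-pw : {f : Pt s → Pt t} → Pointwise s t f → Computable s t f
comp-pw F .graph =
  semi-pw (pw-pair (pw-pair (pw-∘ F (pw-∘ pw-fst pw-fst)) (pw-∘ pw-snd pw-fst)) pw-snd) semi-enc

-- Since `pair` is not onto, comparing the two projections of j with the entries is not enough; the
-- third conjunct requires j to be a pair.
comp-pair : {f : Pt s → Pt t} {g : Pt s → Pt u} →
            Computable s t f → Computable s u g → Computable s (t ⊠ u) < f , g >
comp-pair {s} {t} {u} {f} {g} F G .graph = semi-⇔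
  (λ ((x , i) , j) → mk⇔
    (λ (e , e′ , e″) → trans (cong₂ pair e e′) e″)
    (λ e → trans (sym (π₁-pair (enc t (f x) i) (enc u (g x) i))) (cong π₁ e) ,
           trans (sym (π₂-pair (enc t (f x) i) (enc u (g x) i))) (cong π₂ e) ,
           subst (λ j → pair (π₁ j) (π₂ j) ≡ j) e
             (cong₂ pair (π₁-pair (enc t (f x) i) (enc u (g x) i)) (π₂-pair (enc t (f x) i) (enc u (g x) i)))))
  (semi-∧ (semi-pw (pw-pair pw-fst (pw-∘ (pw-num₁ π₁ rec-π₁) pw-snd)) (F .graph))
    (semi-∧ (semi-pw (pw-pair pw-fst (pw-∘ (pw-num₁ π₂ rec-π₂) pw-snd)) (G .graph))
      (semi-pw (pw-∘ (pw-pair (pw-num₁ (λ j → pair (π₁ j) (π₂ j)) (ap₂ pair rec-pair rec-π₁ rec-π₂)) pw-id)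
                     pw-snd)
        semi-≡)))

comp-∘ : {f : Pt s → Pt t} {g : Pt t → Pt u} →
         Computable t u g → Computable s t f → Computable s u (g ∘ f)
comp-∘ G F .graph = semi-comp (comp-pair (comp-pair
    (computable (semi-pw
      (pw-pair (pw-pair (pw-∘ pw-fst (pw-∘ pw-fst (pw-∘ pw-fst pw-fst))) (pw-∘ pw-snd pw-fst)) pw-snd) (F .graph)))
    (comp-pw (pw-∘ pw-snd pw-fst))) (comp-pw pw-snd)) (G .graph)

comp-curry : {f : Pt s → ℕ → ℕ} →
             Computable (s ⊠ nat) nat (λ p → f (proj₁ p) (proj₂ p)) → Computable s baire f
-- A number is encoded by a constant sequence, so its value can be read off at index 0.
comp-curry F .graph = semi-pw (pw-pair (pw-pair pw-fst (pw-const 0)) pw-snd) (F .graph)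

comp-app : {f : Pt s → ℕ → ℕ} {a : Pt s → ℕ} →
           Computable s baire f → Computable s nat a → Computable s nat (λ x → f x (a x))
comp-app F A = comp-∘ {g = λ p → proj₁ p (proj₂ p)}
  (computable (semi-pw (pw-pair (pw-∘ pw-fst pw-fst) pw-snd) semi-enc)) (comp-pair F A)

comp-⋆ : Computable baire baire _⋆
comp-⋆ .graph = semi-pw (pw-pair (pw-pair (pw-∘ pw-fst pw-fst)
  (pw-∘ (pw-num₁ suc rec-suc) (pw-∘ pw-snd pw-fst))) pw-snd) semi-enc

if-zero : ℕ → ℕ → ℕ → ℕ
if-zero zero    a b = a
if-zero (suc _) a b = b

rec-if-zero : Recursive {3} (λ v → if-zero (lookup v 0F) (lookup v 1F) (lookup v 2F))
rec-if-zero = rec (proj 0F) (proj 3F) (λ _ → refl) (λ _ _ → refl)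

comp-if-zero : {c a b : Pt s → ℕ} → Computable s nat c → Computable s nat a → Computable s nat b →
               Computable s nat (λ x → if-zero (c x) (a x) (b x))
comp-if-zero C A B = comp-∘ {g = λ p → if-zero (proj₁ p) (proj₁ (proj₂ p)) (proj₂ (proj₂ p))} (comp-pw cond)
  (comp-pair C (comp-pair A B))
  where
  cond : Pointwise (nat ⊠ (nat ⊠ nat)) nat (λ p → if-zero (proj₁ p) (proj₁ (proj₂ p)) (proj₂ (proj₂ p)))
  cond .op i y = if-zero (π₁ y) (π₁ (π₂ y)) (π₂ (π₂ y))
  cond .rec-op = ap₃ if-zero rec-if-zero (ap₁ π₁ rec-π₁ (proj 1F)) (ap₁ π₁ rec-π₁ (ap₁ π₂ rec-π₂ (proj 1F)))
    (ap₁ π₂ rec-π₂ (ap₁ π₂ rec-π₂ (proj 1F)))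
  cond .enc-op (c , a , b) i = trans
    (cong₂ (λ c p → if-zero c (π₁ p) (π₂ p)) (π₁-pair c (pair a b)) (π₂-pair c (pair a b)))
    (cong₂ (if-zero c) (π₁-pair a b) (π₂-pair a b))

-- The value on the set is 0, so that `if-zero` takes its first branch there.
χ : {P : Pred (Pt s) 0ℓ} → Decidable P → Pt s → ℕ
χ P? x with P? x
... | yes _ = 0
... | no _  = 1

comp-χ : {P : Pred (Pt s) 0ℓ} (P? : Decidable P) →
         Semirecursive s P → Semirecursive s (¬_ ∘ P) → Computable s nat (χ {s} P?)
comp-χ {s} {P} P? p q .graph = semi-⇔ (λ ((x , _) , j) → χ⇔ x j)
  (semi-∨ (semi-∧ (semi-pw (pw-∘ pw-fst pw-fst) p) (semi-pw (pw-pair (pw-const 0) pw-snd) semi-≡))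
          (semi-∧ (semi-pw (pw-∘ pw-fst pw-fst) q) (semi-pw (pw-pair (pw-const 1) pw-snd) semi-≡)))
  where
  χ⇔ : ∀ x j → ((P x × 0 ≡ j) ⊎ (¬ P x × 1 ≡ j)) ⇔ χ {s} P? x ≡ j
  χ⇔ x j with P? x
  ... | yes a = mk⇔ [ proj₂ , (λ (¬a , _) → contradiction a ¬a) ] (λ e → inj₁ (a , e))
  ... | no ¬a = mk⇔ [ (λ (a , _) → contradiction a ¬a) , proj₂ ] (λ e → inj₂ (¬a , e))

-- Entry i of `f x` is read off the centre of any ball of radius 1/(i+1) about a dense point that
-- contains `f x`.
recursiveMap⇒computable : {f : Pt s → ℕ → ℕ} → RecursiveMap ⟦ s ⟧ ω^ω f → Computable s baire f
recursiveMap⇒computable {s} {f} F .graph = semi-⇔ value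
  (semi-∃ (semi-∧
    (semi-pw (pw-pair (pw-∘ pw-fst (pw-∘ pw-fst pw-fst)) (pw-∘ (pw-num₂ (λ c i → ball c 1 i) rec-unit-ball) ci))
      (semi-Σ⁰₁ (s ⊠ nat) F))
    (semi-pw (pw-pair (pw-∘ (pw-num₂ ⟪_⟫ rec-⟪⟫) ci) (pw-∘ pw-snd pw-fst)) semi-≡)))
  where
  ci : Pointwise (((s ⊠ nat) ⊠ nat) ⊠ nat) (nat ⊠ nat) (λ (((_ , i) , _) , c) → c , i)
  ci = pw-pair pw-snd (pw-∘ pw-snd (pw-∘ pw-fst pw-fst))
  rec-unit-ball : Recursive₂ (λ c i → ball c 1 i)
  rec-unit-ball = rec-ball (proj 0F) (constant 1) (proj 1F)
  value : ∀ z → let ((x , i) , j) = z in (∃ λ c → f x ∈ N ω^ω (ball c 1 i) × ⟪ c ⟫ i ≡ j) ⇔ f x i ≡ j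
  value ((x , i) , j) = mk⇔
    (λ (c , near , e) → trans
      (proj₂ (to (d<⇔Agree baire (f x) ⟪ c ⟫ 1 i) (to (N-ball ω^ω (f x) c 1 i) near)) i ≤-refl) e)
    (λ e → let (c , near) = RecPolish.dense ω^ω (f x) (frac 1 i) (frac-pos 0 i) in
      c , from (N-ball ω^ω (f x) c 1 i) near ,
      trans (sym (proj₂ (to (d<⇔Agree baire (f x) ⟪ c ⟫ 1 i) near) i ≤-refl)) e)

computable⇒recursiveMap : {f : Pt s → Pt t} → Computable s t f → RecursiveMap ⟦ s ⟧ ⟦ t ⟧ f
computable⇒recursiveMap {s = s} {t = t} F =
  Σ⁰₁-semi (s ⊠ nat) (semi-comp (comp-pair (comp-∘ F (comp-pw pw-fst)) (comp-pw pw-snd)) (semi-N t))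

-- Universal sets, partial values and the recursion theorem.

module Relativised (𝔾 : GoodParametrization) where
  open GoodParametrization 𝔾
  open Codes 𝔾

  -- Pointwise equal sequences need not be identical, but `G` is a union of balls, and balls depend
  -- only on the entries.
  G-≗ : ∀ Y {α β} → α ≗ β → ∀ y → (α , y) ∈ G Y → (β , y) ∈ G Y
  G-≗ Y {α} {β} e y g =
    let (ε , _ , ⊆ , ⊇) = G-Σ⁰₁ Y ; (i , near) = ⊆ g ; (p , q) = to (N-⊗ ω^ω Y (ε i) α y) near in
    ⊇ (i , from (N-⊗ ω^ω Y (ε i) β y) (N-≗ (left (ε i)) p , q))
    where
    N-≗ : ∀ k → α ∈ N ω^ω k → β ∈ N ω^ω k
    N-≗ k (0<q , h) = 0<q , λ n le → trans (sym (e n)) (h n le)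

  -- Both sequences lie in the same balls, and a ball of radius 1/(n+1) about a dense point fixes
  -- entry n.
  value-unique : ∀ {ε i β β′} → IsValue ω ω^ω ε i β → IsValue ω ω^ω ε i β′ → β ≗ β′
  value-unique {β = β} {β′} v v′ n =
    let (c , near) = RecPolish.dense ω^ω β (frac 1 n) (frac-pos 0 n)
        near′ = from (v′ (ball c 1 n)) (to (v (ball c 1 n)) (from (N-ball ω^ω β c 1 n) near))
    in trans (at β c near) (sym (at β′ c (to (N-ball ω^ω β′ c 1 n) near′)))
    where
    at : ∀ α c → RecPolish.d ω^ω α (RecPolish.r ω^ω c) <ᵣ frac 1 n → α n ≡ ⟪ c ⟫ n
    at α c near = proj₂ (to (d<⇔Agree baire α ⟪ c ⟫ 1 n) near) n ≤-refl

  opaque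

    -- Q is a union of products of two balls, and the balls containing {ε}(i) are
    -- enumerated by G.
    semi-at-value : {Q : Pred (Pt (baire ⊠ s)) 0ℓ} → Semirecursive (baire ⊠ s) Q →
      ∃ λ (Q̂ : Pred (Pt ((baire ⊠ nat) ⊠ s)) 0ℓ) → Semirecursive ((baire ⊠ nat) ⊠ s) Q̂ ×
        (∀ ε i β w → IsValue ω ω^ω ε i β → Q̂ ((ε , i) , w) ⇔ Q (β , w))
    semi-at-value {s} {Q} q =
      let (η , rec-η , ⊆ , ⊇) = Σ⁰₁-semi (baire ⊠ s) q in
      (λ ((ε , i) , w) → ∃ λ n → (ε , i , left (η n)) ∈ G (ω ⊗ ω) × w ∈ N ⟦ s ⟧ (right (η n))) ,
      semi-∃ (semi-∧
        (semi-pw (pw-pair (pw-∘ pw-fst (pw-∘ pw-fst pw-fst)) (pw-pair (pw-∘ pw-snd (pw-∘ pw-fst pw-fst))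
            (pw-∘ (pw-num₁ left rec-left) (pw-∘ (pw-num₁ η rec-η) pw-snd))))
          (semi-Σ⁰₁ (baire ⊠ (nat ⊠ nat)) (G-Σ⁰₁ (ω ⊗ ω))))
        (semi-pw (pw-pair (pw-∘ pw-snd pw-fst) (pw-∘ (pw-num₁ right rec-right) (pw-∘ (pw-num₁ η rec-η) pw-snd)))
          (semi-N s))) ,
      λ ε i β w v → mk⇔
        (λ (n , g , w∈) → ⊇ (n , from (N-⊗ ω^ω ⟦ s ⟧ (η n) β w) (from (v (left (η n))) g , w∈)))
        (λ h → let (n , near) = ⊆ h ; (β∈ , w∈) = to (N-⊗ ω^ω ⟦ s ⟧ (η n) β w) near in
          n , to (v (left (η n))) β∈ , w∈)

  opaque

    Universal : (s : Shape) → Pred (∣ ω^ω ∣ × Pt s) 0ℓ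
    Universal s = G ⟦ s ⟧

    specialise : (s t : Shape) → Pt (baire ⊠ s) → ∣ ω^ω ∣
    specialise s t = proj₁ (S ⟦ s ⟧ ⟦ t ⟧ (type≤1 s))

    comp-specialise : ∀ s t → Computable (baire ⊠ s) baire (specialise s t)
    comp-specialise s t = recursiveMap⇒computable {baire ⊠ s} (proj₁ (proj₂ (S ⟦ s ⟧ ⟦ t ⟧ (type≤1 s))))

    specialise⇔ : ∀ s t γ x y → (γ , x , y) ∈ Universal (s ⊠ t) ⇔ (specialise s t (γ , x) , y) ∈ Universal t
    specialise⇔ s t = proj₂ (proj₂ (S ⟦ s ⟧ ⟦ t ⟧ (type≤1 s)))

    universal : {P : Pred (Pt s) 0ℓ} → Semirecursive s P → ∃ λ δ → Recursive₁ δ × P ≐ section (Universal s) δ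
    universal {s} {P} p = to (Σ⁰₁⇔ ⟦ s ⟧ P) (Σ⁰₁-semi s p)

    Universal⇔G : ∀ γ i k → (γ , i , k) ∈ Universal (nat ⊠ nat) ⇔ (γ , i , k) ∈ G (ω ⊗ ω)
    Universal⇔G γ i k = mk⇔ id id

  Value : Ord → ∣ ω^ω ∣ → ℕ → Set
  Value ξ δ i = ∃ λ β → IsValue ω ω^ω δ i β × ∃ λ η → 𝟙 ≼ η × η ≺ ξ × BC η β

  diagonal : Shape → ∣ ω^ω ∣ → ∣ ω^ω ∣
  diagonal s α = specialise baire s (α , α)

  comp-diagonal : ∀ s → Computable baire baire (diagonal s)
  comp-diagonal s = comp-∘ (comp-specialise baire s) (comp-pw (pw-pair pw-id pw-id))

  -- If δ is a recursive index of P, self-application by `diagonal` gives an index of the section of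
  -- P at δ itself.
  recursion-theorem : {P : Pred (Pt (baire ⊠ s)) 0ℓ} → Semirecursive (baire ⊠ s) P →
    ∃ λ δ → Recursive₁ δ × ∀ z → (diagonal s δ , z) ∈ Universal s ⇔ P (δ , z)
  recursion-theorem {s} p =
    let (δ , rec-δ , ⊆ , ⊇) = universal p ; spec = specialise⇔ baire s δ δ
    in δ , rec-δ , λ z → mk⇔ (⊇ ∘ from (spec z)) (to (spec z) ∘ ⊆)

-- Construction of the section code.

module SectionCode (𝔾 : GoodParametrization) (s : Shape) where
  open GoodParametrization 𝔾
  open Codes 𝔾
  open Relativised 𝔾

  opaque

    sectionBall : ∣ ⟦ s ⟧ ∣ → ℕ → ℕ
    sectionBall x k = if-zero (χ {s ⊠ nat} (λ p → N? s (proj₂ p) (proj₁ p)) (x , left k)) (right k) 0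

    -- One index serves every `Y`: `right` is computed from k alone, and the index 0 taken when x is
    -- outside the first factor is empty in every space.
    sectionBall⇔ : ∀ Y x y k → y ∈ N Y (sectionBall x k) ⇔ (x , y) ∈ N (⟦ s ⟧ ⊗ Y) k
    sectionBall⇔ Y x y k with N? s (left k) x
    ... | yes x∈ = mk⇔ (λ y∈ → from (N-⊗ ⟦ s ⟧ Y k x y) (x∈ , y∈)) (proj₂ ∘ to (N-⊗ ⟦ s ⟧ Y k x y))
    ... | no ¬x∈ = mk⇔ (λ y∈ → contradiction y∈ (N0-empty Y y))
                       (λ p → contradiction (proj₁ (to (N-⊗ ⟦ s ⟧ Y k x y) p)) ¬x∈)

    comp-sectionBall : Computable (s ⊠ nat) nat (λ p → sectionBall (proj₁ p) (proj₂ p))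
    comp-sectionBall = comp-if-zero
      (comp-∘ (comp-χ (λ p → N? s (proj₂ p) (proj₁ p)) (semi-N s) (semi-∉N s))
              (comp-pw (pw-pair pw-fst (pw-∘ (pw-num₁ left rec-left) pw-snd))))
      (comp-pw (pw-∘ (pw-num₁ right rec-right) pw-snd))
      (comp-pw (pw-const 0))

  args : Shape
  args = (baire ⊠ s) ⊠ (nat ⊠ nat)

  -- With α = δ from fixedPoint, this is a code of the partial function i ↦ u({γ*}(i),x).
  unfolded : Pt (baire ⊠ (baire ⊠ s)) → ∣ ω^ω ∣
  unfolded (α , p) = specialise (baire ⊠ s) (nat ⊠ nat) (diagonal args α , p)

  -- Entry 0 is copied from γ, so the kind of code is kept. In the last branch `pred` undoes the
  -- shift caused by this leading entry.
  F : Pt (baire ⊠ (baire ⊠ s)) → ℕ → ℕ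
  F (α , γ , x) n = if-zero n (γ 0) (if-zero (γ 0) (sectionBall x (γ n)) (unfolded (α , γ , x) (pred n)))

  comp-F : Computable (baire ⊠ (baire ⊠ s)) baire F
  comp-F = comp-curry (comp-if-zero (comp-pw pw-snd) γ0
    (comp-if-zero γ0
      (comp-∘ comp-sectionBall (comp-pair (comp-pw (pw-∘ pw-snd γx)) (comp-app γ (comp-pw pw-snd))))
      (comp-app
        (comp-∘ (comp-specialise (baire ⊠ s) (nat ⊠ nat))
          (comp-pair (comp-∘ (comp-diagonal args) (comp-pw (pw-∘ pw-fst pw-fst))) (comp-pw γx)))
        (comp-pw (pw-∘ (pw-num₁ pred rec-pred) pw-snd)))))
    where
    γx : Pointwise ((baire ⊠ (baire ⊠ s)) ⊠ nat) (baire ⊠ s) (λ p → proj₂ (proj₁ p))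
    γx = pw-∘ pw-snd pw-fst
    γ : Computable ((baire ⊠ (baire ⊠ s)) ⊠ nat) baire (λ p → proj₁ (proj₂ (proj₁ p)))
    γ = comp-pw (pw-∘ pw-fst γx)
    γ0 : Computable ((baire ⊠ (baire ⊠ s)) ⊠ nat) nat (λ p → proj₁ (proj₂ (proj₁ p)) 0)
    γ0 = comp-app γ (comp-pw (pw-const 0))

  -- By `semi-at-value`, that `F` at the value of `γ ⋆` at i lies in the k-th ball is equivalent to
  -- a semirecursive condition, which makes sense even where there is no value. The recursion
  -- theorem applies to that condition.
  fixedPoint : ∃ λ δ → Recursive₁ δ × (∀ γ x i k β → IsValue ω ω^ω (γ ⋆) i β →
    (diagonal args δ , (γ , x) , i , k) ∈ Universal args ⇔ F (δ , β , x) ∈ N ω^ω k)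
  fixedPoint =
    let (Q , q , Q⇔) = semi-at-value {baire ⊠ (s ⊠ nat)} {λ (β , α , x , k) → F (α , β , x) ∈ N ω^ω k}
          (semi-comp (comp-pair
              (comp-∘ comp-F (comp-pw
                (pw-pair (pw-∘ pw-fst pw-snd) (pw-pair pw-fst (pw-∘ pw-fst (pw-∘ pw-snd pw-snd))))))
              (comp-pw (pw-∘ pw-snd (pw-∘ pw-snd pw-snd))))
            (semi-N baire))
        -- `α` stands for the index itself: `F` applies `diagonal` to it, so at δ it refers to the
        -- very set being defined.
        (δ , rec-δ , δ⇔) = recursion-theorem {args}
          {λ (α , (γ , x) , i , k) → Q ((γ ⋆ , i) , α , x , k)}
          (semi-comp (comp-pair
              (comp-pair (comp-∘ comp-⋆ (comp-pw (pw-∘ pw-fst (pw-∘ pw-fst pw-snd))))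
                         (comp-pw (pw-∘ pw-fst (pw-∘ pw-snd pw-snd))))
              (comp-pw (pw-pair pw-fst
                (pw-pair (pw-∘ pw-snd (pw-∘ pw-fst pw-snd)) (pw-∘ pw-snd (pw-∘ pw-snd pw-snd))))))
            q)
    in δ , rec-δ , λ γ x i k β v → δ⇔ ((γ , x) , i , k) ⇔∘ Q⇔ (γ ⋆) i β (δ , x , k) v

  -- Correctness of the section code, by induction on codes.

  module _ (δ : ∣ ω^ω ∣) (rec-δ : Recursive₁ δ)
           (fixed : ∀ γ x i k β → IsValue ω ω^ω (γ ⋆) i β →
             (diagonal args δ , (γ , x) , i , k) ∈ Universal args ⇔ F (δ , β , x) ∈ N ω^ω k) where

    sectionCode : ∣ ω^ω ⊗ ⟦ s ⟧ ∣ → ∣ ω^ω ∣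
    sectionCode p = F (δ , p)

    sectionCode-recursive : RecursiveMap (ω^ω ⊗ ⟦ s ⟧) ω^ω sectionCode
    sectionCode-recursive =
      computable⇒recursiveMap {baire ⊠ s} {baire} (comp-∘ comp-F (comp-pw (pw-pair (pw-constˢ rec-δ) pw-id)))

    sectionCode-open : ∀ γ x → γ 0 ≡ 0 → ∀ i → (sectionCode (γ , x) ⋆) i ≡ sectionBall x ((γ ⋆) i)
    sectionCode-open γ x e i =
      cong (λ c → if-zero c (sectionBall x (γ (suc i))) (unfolded (δ , γ , x) i)) e

    -- The tail of the section code is pointwise `unfolded`. The parametrization turns its
    -- parameters γ and x back into arguments, and the fixed point equation evaluates the result.
    sectionCode-value : ∀ γ x i β → γ 0 ≡ 1 → IsValue ω ω^ω (γ ⋆) i β →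
                        IsValue ω ω^ω (sectionCode (γ , x) ⋆) i (sectionCode (β , x))
    sectionCode-value γ x i β e v k =
      mk⇔ (G-≗ (ω ⊗ ω) (sym ∘ eq) (i , k) ∘ to code⇔) (from code⇔ ∘ G-≗ (ω ⊗ ω) eq (i , k))
      where
      eq : (sectionCode (γ , x) ⋆) ≗ unfolded (δ , γ , x)
      eq n = cong (λ c → if-zero c (sectionBall x (γ (suc n))) (unfolded (δ , γ , x) n)) e
      code⇔ : sectionCode (β , x) ∈ N ω^ω k ⇔ (unfolded (δ , γ , x) , i , k) ∈ G (ω ⊗ ω)
      code⇔ = mk⇔ (from f) (to f) ⇔∘ specialise⇔ (baire ⊠ s) (nat ⊠ nat) (diagonal args δ) (γ , x) (i , k) ⇔∘
        Universal⇔G (unfolded (δ , γ , x)) i k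
        where f = fixed γ x i k β v

    mutual

      -- Entry 0 agrees with `γ 0` by computation, and each component keeps its ordinal η, so the
      -- rank does not grow.
      sectionCode-BC : ∀ {ξ γ} → BC ξ γ → ∀ x → BC ξ (sectionCode (γ , x))
      sectionCode-BC (bc₁ ξ≼1 1≼ξ e) x = bc₁ ξ≼1 1≼ξ e
      sectionCode-BC {ξ} {γ} (bc₂ 2≼ξ e f) x = bc₂ 2≼ξ e λ i → sectionCode-Value {ξ} {γ} {i} e (f i) x

      sectionCode-Value : ∀ {ξ γ i} → γ 0 ≡ 1 → Value ξ (γ ⋆) i → ∀ x → Value ξ (sectionCode (γ , x) ⋆) i
      sectionCode-Value {ξ} {γ} {i} e (β , v , η , 1≼η , η≺ξ , b) x =
        sectionCode (β , x) , sectionCode-value γ x i β e v , η , 1≼η , η≺ξ , sectionCode-BC b x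

    module _ (Y : RecPolish) (x : ∣ ⟦ s ⟧ ∣) where
      mutual

        -- The induction runs over two independent derivations, since ρ depends on a membership
        -- proof. `γ′` is only pointwise equal to the section code because values are unique only up
        -- to pointwise equality.
        ρ-section : ∀ {ξ ξ′ γ γ′} (b : BC ξ γ) (c : BC ξ′ γ′) → γ′ ≗ sectionCode (γ , x) →
                    ∀ y → ρ-BC Y c y ⇔ ρ-BC (⟦ s ⟧ ⊗ Y) b (x , y)
        ρ-section {γ = γ} {γ′} (bc₁ _ _ e) (bc₁ _ _ _) γ′≗ y = mk⇔
          (λ (i , y∈) → i , to (sectionBall⇔ Y x y (γ (suc i))) (subst (λ k → y ∈ N Y k) (eq i) y∈))
          (λ (i , y∈) → i , subst (λ k → y ∈ N Y k) (sym (eq i)) (from (sectionBall⇔ Y x y (γ (suc i))) y∈))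
          where
          eq : ∀ i → γ′ (suc i) ≡ sectionBall x (γ (suc i))
          eq i = trans (γ′≗ (suc i)) (sectionCode-open γ x e i)
        -- In the mixed cases entry 0 of `γ′` would be both 0 and 1.
        ρ-section (bc₁ _ _ e) (bc₂ _ e′ _) γ′≗ y with () ← trans (sym e′) (trans (γ′≗ 0) e)
        ρ-section (bc₂ _ e _) (bc₁ _ _ e′) γ′≗ y with () ← trans (sym e′) (trans (γ′≗ 0) e)
        ρ-section {ξ} {ξ′} {γ} {γ′} (bc₂ _ e f) (bc₂ _ _ g) γ′≗ y = mk⇔
          (map₂ λ {i} ¬p q → ¬p (from (ρ-value-section {ξ} {ξ′} {γ} {γ′} {i} e (f i) (g i) γ′≗ y) q))
          (map₂ λ {i} ¬p q → ¬p (to (ρ-value-section {ξ} {ξ′} {γ} {γ′} {i} e (f i) (g i) γ′≗ y) q))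

        ρ-value-section : ∀ {ξ ξ′ γ γ′ i} → γ 0 ≡ 1 → (b : Value ξ (γ ⋆) i) (c : Value ξ′ (γ′ ⋆) i) →
                          γ′ ≗ sectionCode (γ , x) → ∀ y →
                          ρ-value Y {ξ′} {γ′ ⋆} {i} c y ⇔ ρ-value (⟦ s ⟧ ⊗ Y) {ξ} {γ ⋆} {i} b (x , y)
        ρ-value-section {γ = γ} {γ′} {i} e (β , v , _ , _ , _ , b) (β′ , v′ , _ , _ , _ , c) γ′≗ y =
          -- Transported along `γ′≗`, `sectionCode-value` makes the section code of β a value at i
          -- of the tail of `γ′`; uniqueness then compares it with β′.
          ρ-section b c (value-unique {γ′ ⋆} {i} v′ (λ k → mk⇔
            (G-≗ (ω ⊗ ω) (λ n → sym (γ′≗ (suc n))) (i , k) ∘ to (sectionCode-value γ x i β e v k))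
            (from (sectionCode-value γ x i β e v k) ∘ G-≗ (ω ⊗ ω) (λ n → γ′≗ (suc n)) (i , k)))) y

lemma3p2 : (𝔾 : GoodParametrization) → let open Codes 𝔾 in
    (X : RecPolish) → Type≤1 X →
    ∃ λ (u : ∣ ω^ω ⊗ X ∣ → ∣ ω^ω ∣) →
    RecursiveMap (ω^ω ⊗ X) ω^ω u ×
    (∀ ξ → 𝟙 ≼ ξ → ∀ γ → γ ∈ BC ξ → ∀ x →
    u (γ , x) ∈ BC ξ ×
    ((Y : RecPolish) (b : γ ∈ BC∞) (c : u (γ , x) ∈ BC∞) →
    ρ Y (u (γ , x)) c ≐ section (ρ (X ⊗ Y) γ b) x))
lemma3p2 𝔾 X X≤1 with shape X≤1
... | s , refl = let (δ , rec-δ , fixed) = fixedPoint in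
  sectionCode δ rec-δ fixed , sectionCode-recursive δ rec-δ fixed , λ ξ _ γ γ∈ x →
  sectionCode-BC δ rec-δ fixed γ∈ x , λ Y (_ , _ , b) (_ , _ , c) →
    (λ {y} → to (ρ-section δ rec-δ fixed Y x b c (λ _ → refl) y)) ,
    (λ {y} → from (ρ-section δ rec-δ fixed Y x b c (λ _ → refl) y))
  where open SectionCode 𝔾 s
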